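{- There is a $5$-dimensional spindle, with $48$ facets and $322$ vertices, of length six.
   Context: Polytopes are convex and bounded. A $d$-spindle is a $d$-dimensional polytope $P$ with two distinguished vertices $u$ and $v$ such that every facet of $P$ contains exactly one of them. The length of a spindle is the distance between $u$ and $v$ in the graph of $P$ (the graph formed by the vertices and edges of $P$). -}

module Defs where

open import Algebra.Bundles using (CommutativeRing)
import Algebra.Properties.CommutativeMonoid.Sum as Sum
open import Data.Fin.Base using (Fin)
open import Data.Nat.Base as ℕ using (ℕ; zero; suc)
open import Data.Product.Base using (Σ; ∃-syntax; _×_; proj₁)
open import Data.Sum.Base using (_⊎_)
open import Data.Vec.Functional using (Vector)
import Data.Vec.Functional.Relation.Binary.Equality.Setoid as VecEquality
open import Function.Bundles using (_⇔_; Bijection)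
open import Function.Construct.Composition using (_⇔-∘_)
open import Function.Construct.Identity using (⇔-id)
open import Function.Construct.Symmetry using (⇔-sym)
open import Level using (Level; _⊔_) renaming (suc to lsuc)
open import Relation.Binary.Bundles using (Setoid)
import Relation.Binary.Construct.On as On
open import Relation.Binary.PropositionalEquality.Properties using (setoid)
open import Relation.Binary.Structures using (IsDecTotalOrder)
open import Relation.Nullary.Negation.Core using (¬_)
open import Relation.Unary using (Pred; _∈_; _∉_)

-- Linearly ordered fields. With classical logic ℝ is one of them; since the
-- order is required to be decidable, so is ℚ constructively.
record OrderedField c ℓ₁ ℓ₂ : Set (lsuc (c ⊔ ℓ₁ ⊔ ℓ₂)) where
  infix 4 _≤_
  field
    commutativeRing : CommutativeRing c ℓ₁
  open CommutativeRing commutativeRing public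
  field
    _≤_             : Carrier → Carrier → Set ℓ₂
    isDecTotalOrder : IsDecTotalOrder _≈_ _≤_
    +-monoˡ-≤       : ∀ z {x y} → x ≤ y → x + z ≤ y + z
    *-nonNegative   : ∀ {x y} → 0# ≤ x → 0# ≤ y → 0# ≤ x * y
    0≉1             : ¬ 0# ≈ 1#
    inverse         : ∀ x → ¬ x ≈ 0# → ∃[ y ] x * y ≈ 1#

HasCardinality : ∀ {a ℓ} → Setoid a ℓ → ℕ → Set (a ⊔ ℓ)
HasCardinality S n = Bijection (setoid (Fin n)) S

module Polyhedral {c ℓ₁ ℓ₂ : Level} (K : OrderedField c ℓ₁ ℓ₂) where

  open OrderedField K hiding (setoid; zero)
  open Sum +-commutativeMonoid using (sum) public
  open VecEquality (OrderedField.setoid K) using (_≋_; ≋-setoid) public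

  Point : ℕ → Set c
  Point n = Vector Carrier n

  infix 7 _·_
  _·_ : ∀ {n} → Point n → Point n → Carrier
  x · y = sum (λ i → x i * y i)

  combination : ∀ {k n} → Vector Carrier k → Vector (Point n) k → Point n
  combination a p j = sum (λ i → a i * p i j)

  AffinelyIndependent : ∀ {k n} → Vector (Point n) k → Set (c ⊔ ℓ₁)
  AffinelyIndependent {k} p = (a : Vector Carrier k) → sum a ≈ 0# →
    combination a p ≋ (λ _ → 0#) → ∀ i → a i ≈ 0#

  AffineHull : ∀ {k n} → Vector (Point n) k → Pred (Point n) (c ⊔ ℓ₁)
  AffineHull {k} p x =
    Σ (Vector Carrier k) λ a → sum a ≈ 1# × combination a p ≋ x

  -- The dimension of a set is the dimension of its affine hull. No k satisfies
  -- this for the empty set.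
  HasDimension : ∀ {n ℓ} → Pred (Point n) ℓ → ℕ → Set (c ⊔ ℓ₁ ⊔ ℓ)
  HasDimension {n} S k = Σ (Vector (Point n) (suc k)) λ p →
    (∀ i → p i ∈ S) × AffinelyIndependent p × (∀ x → x ∈ S → x ∈ AffineHull p)

  -- A bounded intersection of finitely many closed half-spaces, given by one
  -- particular (possibly redundant) system of inequalities. Faces and dimension
  -- below depend only on the underlying point set.
  record Polytope (n : ℕ) : Set (c ⊔ ℓ₂) where
    field
      {size}  : ℕ
      normal  : Vector (Point n) size
      offset  : Vector Carrier size

    points : Pred (Point n) ℓ₂
    points x = ∀ i → normal i · x ≤ offset i

    field
      bounded : ∃[ M ] (∀ x → x ∈ points → ∀ j → - M ≤ x j × x j ≤ M)

  open Polytope public using (points)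

  module _ {n : ℕ} (P : Polytope n) where

    -- The subset of P on which a valid inequality is tight; P itself and the
    -- empty set are included.
    record Face : Set (c ⊔ ℓ₂) where
      field
        direction : Point n
        value     : Carrier
        valid     : ∀ x → x ∈ points P → direction · x ≤ value

      facePoints : Pred (Point n) (ℓ₁ ⊔ ℓ₂)
      facePoints x = x ∈ points P × direction · x ≈ value

    open Face public using (facePoints)

    IsFacet : Pred Face (c ⊔ ℓ₁ ⊔ ℓ₂)
    IsFacet F =
      ∃[ k ] HasDimension (points P) (suc k) × HasDimension (facePoints F) k

    IsEdge : Pred Face (c ⊔ ℓ₁ ⊔ ℓ₂)
    IsEdge F = HasDimension (facePoints F) 1

    IsVertex : Pred (Point n) (c ⊔ ℓ₁ ⊔ ℓ₂)
    IsVertex v = Σ Face λ F → ∀ x → x ∈ facePoints F ⇔ x ≋ v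

    -- Distinct inequalities may define the same face, so faces are compared as
    -- point sets.
    faceSetoid : Setoid (c ⊔ ℓ₂) (c ⊔ ℓ₁ ⊔ ℓ₂)
    faceSetoid = record
      { Carrier       = Face
      ; _≈_           = λ F G → ∀ x → x ∈ facePoints F ⇔ x ∈ facePoints G
      ; isEquivalence = record
        { refl  = λ x → ⇔-id _
        ; sym   = λ F≈G x → ⇔-sym (F≈G x)
        ; trans = λ F≈G G≈H x → G≈H x ⇔-∘ F≈G x
        }
      }

    facetSetoid : Setoid (c ⊔ ℓ₁ ⊔ ℓ₂) (c ⊔ ℓ₁ ⊔ ℓ₂)
    facetSetoid = On.setoid {B = Σ Face IsFacet} faceSetoid proj₁

    vertexSetoid : Setoid (c ⊔ ℓ₁ ⊔ ℓ₂) ℓ₁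
    vertexSetoid = On.setoid {B = Σ (Point n) IsVertex} (≋-setoid n) proj₁

    Adjacent : Point n → Point n → Set (c ⊔ ℓ₁ ⊔ ℓ₂)
    Adjacent x y = IsVertex x × IsVertex y × ¬ x ≋ y ×
      Σ Face λ E → IsEdge E × x ∈ facePoints E × y ∈ facePoints E

    data Walk : ℕ → Point n → Point n → Set (c ⊔ ℓ₁ ⊔ ℓ₂) where
      stop : ∀ {x y} → x ≋ y → Walk 0 x y
      step : ∀ {m x y z} → Adjacent x y → Walk m y z → Walk (suc m) x z

    Distance : Point n → Point n → ℕ → Set (c ⊔ ℓ₁ ⊔ ℓ₂)
    Distance x y d = Walk d x y × (∀ m → Walk m x y → d ℕ.≤ m)

  -- The ambient dimension n is independent of the dimension d of the polytope.
  record Spindle (n d : ℕ) : Set (c ⊔ ℓ₁ ⊔ ℓ₂) where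
    field
      polytope     : Polytope n
      hasDimension : HasDimension (points polytope) d
      u v          : Point n
      u-vertex     : IsVertex polytope u
      v-vertex     : IsVertex polytope v
      u≉v          : ¬ u ≋ v
      exactlyOne   : ∀ F → IsFacet polytope F →
                       (u ∈ facePoints F × v ∉ facePoints F) ⊎
                       (u ∉ facePoints F × v ∈ facePoints F)

  module _ {n d : ℕ} (S : Spindle n d) where
    open Spindle S

    FacetCount : ℕ → Set (c ⊔ ℓ₁ ⊔ ℓ₂)
    FacetCount = HasCardinality (facetSetoid polytope)

    VertexCount : ℕ → Set (c ⊔ ℓ₁ ⊔ ℓ₂)
    VertexCount = HasCardinality (vertexSetoid polytope)

    Length : ℕ → Set (c ⊔ ℓ₁ ⊔ ℓ₂)
    Length = Distance polytope u v

{-# OPTIONS --safe #-}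
module Submission where

-- Santos's spindle is P = { x : q · x ≤ 1 }, where the 48 normals q have height ±1, so
-- that the apices are the two unit points on the axis. The crucial point is that the 322
-- listed points are all the vertices of P, that is, that every linear functional d attains
-- its maximum over P at one of them. Changing signs, assume that d is nonnegative on all
-- coordinates but the height. Such functionals are covered by 44 simplicial cones that
-- refine the normal fan, the normal cones of a simple polyhedron: at the corner of that
-- polyhedron where d is largest no edge improves d, so d lies in the cone of that corner,
-- and d is maximal over P at the corresponding vertex.
--
-- The rest is combinatorial. If b lies in a face F and every inequality that is tight at b
-- is tight at z ∈ P, then z ∈ F. With b in the relative interior, a facet lies on one of
-- the 48 hyperplanes and is therefore cut out by it; with b the midpoint of two adjacent
-- vertices, no third vertex lies on all their common facets. The latter bounds the growth
-- of an integer level along edges, and the apices have levels 0 and 6.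

open import Defs
import Algebra.Properties.Ring as RingProperties
import Algebra.Properties.Semiring.Mult as Mult
import Algebra.Properties.Semiring.Sum as SemiringSum
import Algebra.Solver.Ring as RingSolver
open import Algebra.Solver.Ring.AlmostCommutativeRing
  using (fromCommutativeRing; _-Raw-AlmostCommutative⟶_)
open import Data.Bool.Base using (Bool; true; false; T; _∧_; _∨_; if_then_else_)
import Data.Bool.Properties as Boolₚ
open import Data.Empty using (⊥)
open import Data.Fin.Base using (Fin; zero; suc; toℕ; fromℕ; fromℕ<; inject₁; punchIn; punchOut)
import Data.Fin.Literals as Finₗ
import Data.Fin.Properties as Finₚ
open import Data.Integer.Base as ℤ using (ℤ; 0ℤ; -1ℤ)
import Data.Integer.Literals as ℤₗ
import Data.Integer.Properties as ℤₚ
open import Data.List.Base as List using (List; []; _∷_; length; map; concatMap; filter)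
open import Data.List.Relation.Unary.All as All using (All; []; _∷_)
open import Data.List.Relation.Unary.AllPairs using (AllPairs; []; _∷_; allPairs?)
open import Data.List.Relation.Unary.Any as Any using (Any; here; there; any?)
open import Data.List.Relation.Unary.Any.Properties using (lookup-index)
open import Data.Maybe.Base using (Maybe; just; nothing)
open import Data.Nat.Base as ℕ using (ℕ; zero; suc; z≤n; s≤s)
import Data.Nat.Literals as ℕₗ
import Data.Nat.Properties as ℕₚ
open import Data.Product.Base as Product using (Σ; ∃; ∃-syntax; _×_; _,_; proj₁; proj₂)
open import Data.Sum.Base using (_⊎_; inj₁; inj₂; [_,_]′)
open import Data.Unit.Base using (⊤; tt)
open import Data.Vec.Base as Vec using (Vec; []; _∷_; lookup; tabulate; zipWith; fromList)
open import Data.Vec.Functional using (Vector; tail)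
import Data.Vec.Properties as Vecₚ
open import Function.Base using (_∘_; id)
open import Function.Bundles using (_⇔_; mk⇔; Equivalence)
open import Level using (Level)
open import Relation.Binary.Definitions using (tri<; tri≈; tri>)
open import Relation.Binary.PropositionalEquality as ≡ using (_≡_; _≢_)
open import Relation.Binary.Structures using (IsDecTotalOrder)
open import Relation.Nullary.Decidable
  using (Dec; yes; no; does; proof; ¬?; _×-dec_; _⊎-dec_; _→-dec_; dec-true; dec-false; decidable-stable; map′)
open import Relation.Nullary.Negation.Core using (¬_; contradiction)
open import Relation.Nullary.Reflects using (Reflects; ofʸ; ofⁿ)

-- Over an arbitrary ordered field no compactness supplies maxima, and a face may be given by any
-- valid functional, so neither vertices nor facets can simply be read off the inequalities. Both
-- are controlled through support functions: once every functional is known to be maximal at a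
-- listed point, perturbing a functional slightly bounds its values on a face, and no point ever has
-- to be written as a convex combination of vertices.
--
-- The certificate for these maxima consists of integers, so that it can be checked by evaluation
-- and carried into every field along the homomorphism from ℤ. The normal fan itself would be an
-- awkward certificate: a vertex may lie on more than five facets (each apex lies on 24), and then
-- its normal cone has dependent generators. Perturbing the right-hand sides cuts such cones into
-- simplicial ones. There the pairing of generators with edge directions is a diagonal matrix, which
-- can be verified entry by entry.

private variable
  c ℓ₁ ℓ₂ ℓ : Level
  m n N L M : ℕ

-- Ordered fields, their order arithmetic and the integers inside them.

module OrderedFieldProperties (K : OrderedField c ℓ₁ ℓ₂) where

  open OrderedField K hiding (zero)
  open RingProperties ring public using (-‿distribˡ-*; -‿distribʳ-*)
  open import Algebra.Properties.AbelianGroup +-abelianGroup public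
    using () renaming (⁻¹-involutive to -‿involutive; ε⁻¹≈ε to -0≈0; ⁻¹-∙-comm to -‿+-comm)
  open Mult semiring using (×-homo-+; ×1-homo-*) renaming (_×_ to _×ᴷ_)
  open import Relation.Binary.Reasoning.Setoid (OrderedField.setoid K)

  module ≤ = IsDecTotalOrder isDecTotalOrder

  fromℤ : ℤ → Carrier
  fromℤ (ℤ.+ n)    = n ×ᴷ 1#
  fromℤ ℤ.-[1+ n ] = - (suc n ×ᴷ 1#)

  private
    cancel-1 : ∀ x y → x - y ≈ (1# + x) - (1# + y)
    cancel-1 x y = sym (begin
      (1# + x) + - (1# + y)   ≈⟨ +-congˡ (-‿+-comm 1# y) ⟨
      (1# + x) + (- 1# - y)   ≈⟨ +-congʳ (+-comm 1# x) ⟩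
      (x + 1#) + (- 1# - y)   ≈⟨ +-assoc x 1# _ ⟩
      x + (1# + (- 1# - y))   ≈⟨ +-congˡ (+-assoc 1# (- 1#) _) ⟨
      x + ((1# - 1#) - y)     ≈⟨ +-congˡ (+-congʳ (-‿inverseʳ 1#)) ⟩
      x + (0# - y)            ≈⟨ +-congˡ (+-identityˡ _) ⟩
      x - y                   ∎)

    fromℤ-⊖ : ∀ m n → fromℤ (m ℤ.⊖ n) ≈ m ×ᴷ 1# - n ×ᴷ 1#
    fromℤ-⊖ zero    zero    = sym (-‿inverseʳ 0#)
    fromℤ-⊖ zero    (suc n) = sym (+-identityˡ _)
    fromℤ-⊖ (suc m) zero    = sym (trans (+-congˡ -0≈0) (+-identityʳ _))
    fromℤ-⊖ (suc m) (suc n) = begin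
      fromℤ (suc m ℤ.⊖ suc n)          ≡⟨ ≡.cong fromℤ (ℤₚ.[1+m]⊖[1+n]≡m⊖n m n) ⟩
      fromℤ (m ℤ.⊖ n)                  ≈⟨ fromℤ-⊖ m n ⟩
      m ×ᴷ 1# - n ×ᴷ 1#                ≈⟨ cancel-1 _ _ ⟩
      suc m ×ᴷ 1# - suc n ×ᴷ 1#        ∎

  fromℤ-neg : ∀ i → fromℤ (ℤ.- i) ≈ - fromℤ i
  fromℤ-neg (ℤ.+ zero)  = sym -0≈0
  fromℤ-neg ℤ.+[1+ n ]  = refl
  fromℤ-neg ℤ.-[1+ n ]  = sym (-‿involutive _)

  fromℤ-+ : ∀ i j → fromℤ (i ℤ.+ j) ≈ fromℤ i + fromℤ j
  fromℤ-+ (ℤ.+ m)    (ℤ.+ n)    = ×-homo-+ 1# m n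
  fromℤ-+ (ℤ.+ m)    ℤ.-[1+ n ] = fromℤ-⊖ m (suc n)
  fromℤ-+ ℤ.-[1+ m ] (ℤ.+ n)    = trans (fromℤ-⊖ n (suc m)) (+-comm _ _)
  fromℤ-+ ℤ.-[1+ m ] ℤ.-[1+ n ] = begin
    - (suc (suc (m ℕ.+ n)) ×ᴷ 1#)      ≡⟨ ≡.cong (λ k → - (suc k ×ᴷ 1#)) (≡.sym (ℕₚ.+-suc m n)) ⟩
    - ((suc m ℕ.+ suc n) ×ᴷ 1#)        ≈⟨ -‿cong (×-homo-+ 1# (suc m) (suc n)) ⟩
    - (suc m ×ᴷ 1# + suc n ×ᴷ 1#)      ≈⟨ -‿+-comm _ _ ⟨
    - (suc m ×ᴷ 1#) - (suc n ×ᴷ 1#)    ∎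

  private
    fromℤ-*⁺ : ∀ m j → fromℤ (ℤ.+ m ℤ.* j) ≈ fromℤ (ℤ.+ m) * fromℤ j
    fromℤ-*⁺ m (ℤ.+ n)    = begin
      fromℤ (ℤ.+ m ℤ.* ℤ.+ n)    ≡⟨ ≡.cong fromℤ (ℤₚ.pos-* m n) ⟨
      (m ℕ.* n) ×ᴷ 1#            ≈⟨ ×1-homo-* m n ⟩
      (m ×ᴷ 1#) * (n ×ᴷ 1#)      ∎
    fromℤ-*⁺ m ℤ.-[1+ n ] = begin
      fromℤ (ℤ.+ m ℤ.* ℤ.-[1+ n ])          ≡⟨ ≡.cong fromℤ (ℤₚ.neg-distribʳ-* (ℤ.+ m) (ℤ.+ suc n)) ⟨
      fromℤ (ℤ.- (ℤ.+ m ℤ.* ℤ.+ suc n))     ≈⟨ fromℤ-neg (ℤ.+ m ℤ.* ℤ.+ suc n) ⟩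
      - fromℤ (ℤ.+ m ℤ.* ℤ.+ suc n)         ≈⟨ -‿cong (fromℤ-*⁺ m (ℤ.+ suc n)) ⟩
      - ((m ×ᴷ 1#) * (suc n ×ᴷ 1#))         ≈⟨ -‿distribʳ-* _ _ ⟩
      (m ×ᴷ 1#) * - (suc n ×ᴷ 1#)           ∎

  fromℤ-* : ∀ i j → fromℤ (i ℤ.* j) ≈ fromℤ i * fromℤ j
  fromℤ-* (ℤ.+ m)    j = fromℤ-*⁺ m j
  fromℤ-* ℤ.-[1+ m ] j = begin
    fromℤ (ℤ.-[1+ m ] ℤ.* j)          ≡⟨ ≡.cong fromℤ (ℤₚ.neg-distribˡ-* (ℤ.+ suc m) j) ⟨
    fromℤ (ℤ.- (ℤ.+ suc m ℤ.* j))     ≈⟨ fromℤ-neg (ℤ.+ suc m ℤ.* j) ⟩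
    - fromℤ (ℤ.+ suc m ℤ.* j)         ≈⟨ -‿cong (fromℤ-*⁺ (suc m) j) ⟩
    - ((suc m ×ᴷ 1#) * fromℤ j)       ≈⟨ -‿distribˡ-* _ _ ⟩
    - (suc m ×ᴷ 1#) * fromℤ j         ∎

  private
    fromℤ-morphism : ℤ.+-*-rawRing -Raw-AlmostCommutative⟶ fromCommutativeRing commutativeRing
    fromℤ-morphism = record
      { ⟦_⟧ = fromℤ ; +-homo = fromℤ-+ ; *-homo = fromℤ-* ; -‿homo = fromℤ-neg
      ; 0-homo = refl ; 1-homo = +-identityʳ 1# }

    fromℤ-≟ : ∀ i j → Maybe (fromℤ i ≈ fromℤ j)
    fromℤ-≟ i j with i ℤₚ.≟ j
    ... | yes i≡j = just (reflexive (≡.cong fromℤ i≡j))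
    ... | no  _   = nothing

  -- Coefficients are taken in ℤ because there they compute and can be compared; cancellations are
  -- then found in every `K`.
  module Solver = RingSolver ℤ.+-*-rawRing (fromCommutativeRing commutativeRing) fromℤ-morphism
    fromℤ-≟

  open Solver using (solve; _:+_; _:*_; _:-_; :-_; _:=_)

  infix 4 _<_
  _<_ : Carrier → Carrier → Set _
  x < y = ¬ y ≤ x

  ≤-respˡ : ∀ {x y z} → x ≈ y → x ≤ z → y ≤ z
  ≤-respˡ = ≤.≲-respˡ-≈

  ≤-respʳ : ∀ {x y z} → x ≈ y → z ≤ x → z ≤ y
  ≤-respʳ = ≤.≲-respʳ-≈

  ≤-resp : ∀ {w x y z} → w ≈ x → y ≈ z → w ≤ y → x ≤ z
  ≤-resp w≈x y≈z = λ w≤y → ≤-respˡ w≈x (≤-respʳ y≈z w≤y)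

  <-resp : ∀ {w x y z} → w ≈ x → y ≈ z → w < y → x < z
  <-resp w≈x y≈z w<y z≤x = w<y (≤-resp (sym y≈z) (sym w≈x) z≤x)

  <⇒≤ : ∀ {x y} → x < y → x ≤ y
  <⇒≤ {x} {y} x<y with ≤.total x y
  ... | inj₁ x≤y = x≤y
  ... | inj₂ y≤x = contradiction y≤x x<y

  <⇒≉ : ∀ {x y} → x < y → ¬ x ≈ y
  <⇒≉ x<y x≈y = x<y (≤.reflexive (sym x≈y))

  ≤∧≉⇒< : ∀ {x y} → x ≤ y → ¬ x ≈ y → x < y
  ≤∧≉⇒< x≤y x≉y y≤x = x≉y (≤.antisym x≤y y≤x)

  <-≤-trans : ∀ {x y z} → x < y → y ≤ z → x < z
  <-≤-trans x<y y≤z z≤x = x<y (≤.trans y≤z z≤x)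

  +-mono-≤ : ∀ {w x y z} → w ≤ x → y ≤ z → w + y ≤ x + z
  +-mono-≤ {w} {x} {y} {z} w≤x y≤z = ≤.trans (+-monoˡ-≤ y w≤x)
    (≤-resp (+-comm y x) (+-comm z x) (+-monoˡ-≤ x y≤z))

  x≤y⇒0≤y-x : ∀ {x y} → x ≤ y → 0# ≤ y - x
  x≤y⇒0≤y-x {x} x≤y = ≤-respˡ (-‿inverseʳ x) (+-monoˡ-≤ (- x) x≤y)

  0≤y-x⇒x≤y : ∀ {x y} → 0# ≤ y - x → x ≤ y
  0≤y-x⇒x≤y {x} {y} 0≤y-x = ≤-resp (+-identityˡ x)
    (solve 2 (λ x y → (y :- x) :+ x := y) refl x y) (+-monoˡ-≤ x 0≤y-x)

  x<y⇒0<y-x : ∀ {x y} → x < y → 0# < y - x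
  x<y⇒0<y-x {x} {y} x<y y-x≤0 = x<y (≤-resp
    (solve 2 (λ x y → (y :- x) :+ x := y) refl x y) (+-identityˡ x) (+-monoˡ-≤ x y-x≤0))

  neg-≤ : ∀ {x y} → x ≤ y → - y ≤ - x
  neg-≤ {x} {y} x≤y = 0≤y-x⇒x≤y (≤-respʳ
    (solve 2 (λ x y → y :- x := :- x :- :- y) refl x y) (x≤y⇒0≤y-x x≤y))

  x≤0⇒0≤-x : ∀ {x} → x ≤ 0# → 0# ≤ - x
  x≤0⇒0≤-x x≤0 = ≤-respˡ -0≈0 (neg-≤ x≤0)

  0≤x⇒-x≤0 : ∀ {x} → 0# ≤ x → - x ≤ 0#
  0≤x⇒-x≤0 0≤x = ≤-respʳ -0≈0 (neg-≤ 0≤x)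

  *-monoˡ-≤ : ∀ {a x y} → 0# ≤ a → x ≤ y → a * x ≤ a * y
  *-monoˡ-≤ {a} {x} {y} 0≤a x≤y = 0≤y-x⇒x≤y (≤-respʳ
    (solve 3 (λ a x y → a :* (y :- x) := a :* y :- a :* x) refl a x y)
    (*-nonNegative 0≤a (x≤y⇒0≤y-x x≤y)))

  *-nonPositive : ∀ {x y} → x ≤ 0# → y ≤ 0# → 0# ≤ x * y
  *-nonPositive {x} {y} x≤0 y≤0 = ≤-respʳ
    (solve 2 (λ x y → (:- x) :* (:- y) := x :* y) refl x y) (*-nonNegative (x≤0⇒0≤-x x≤0) (x≤0⇒0≤-x y≤0))

  0≤1 : 0# ≤ 1#
  0≤1 with ≤.total 0# 1#
  ... | inj₁ 0≤1 = 0≤1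
  ... | inj₂ 1≤0 = ≤-respʳ (*-identityˡ 1#) (*-nonPositive 1≤0 1≤0)

  0<1 : 0# < 1#
  0<1 = ≤∧≉⇒< 0≤1 0≉1

  no-zero-divisors : ∀ {x y} → x * y ≈ 0# → ¬ x ≈ 0# → y ≈ 0#
  no-zero-divisors {x} {y} xy≈0 x≉0 with inverse x x≉0
  ... | x⁻¹ , xx⁻¹≈1 = begin
    y              ≈⟨ *-identityˡ y ⟨
    1# * y         ≈⟨ *-congʳ xx⁻¹≈1 ⟨
    x * x⁻¹ * y    ≈⟨ solve 3 (λ x z y → x :* z :* y := z :* (x :* y)) refl x x⁻¹ y ⟩
    x⁻¹ * (x * y)  ≈⟨ *-congˡ xy≈0 ⟩
    x⁻¹ * 0#       ≈⟨ zeroʳ x⁻¹ ⟩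
    0#             ∎

  *-cancelˡ-≈ : ∀ {a x y} → ¬ a ≈ 0# → a * x ≈ a * y → x ≈ y
  *-cancelˡ-≈ {a} {x} {y} a≉0 ax≈ay = begin
    x            ≈⟨ solve 2 (λ x y → x := (x :- y) :+ y) refl x y ⟩
    (x - y) + y  ≈⟨ +-congʳ (no-zero-divisors (begin
      a * (x - y)    ≈⟨ solve 3 (λ a x y → a :* (x :- y) := a :* x :- a :* y) refl a x y ⟩
      a * x - a * y  ≈⟨ +-congʳ ax≈ay ⟩
      a * y - a * y  ≈⟨ -‿inverseʳ _ ⟩
      0#             ∎) a≉0) ⟩
    0# + y       ≈⟨ +-identityˡ y ⟩
    y            ∎

  *-cancelˡ-≤ : ∀ {a x y} → 0# < a → a * x ≤ a * y → x ≤ y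
  *-cancelˡ-≤ {a} {x} {y} 0<a ax≤ay with ≤.total x y
  ... | inj₁ x≤y = x≤y
  ... | inj₂ y≤x = ≤.reflexive (*-cancelˡ-≈ (λ a≈0 → <⇒≉ 0<a (sym a≈0))
                     (≤.antisym ax≤ay (*-monoˡ-≤ (<⇒≤ 0<a) y≤x)))

  *-pos : ∀ {x y} → 0# < x → 0# < y → 0# < x * y
  *-pos {x} {y} 0<x 0<y xy≤0 = 0<y (*-cancelˡ-≤ 0<x (≤-respʳ (sym (zeroʳ x)) xy≤0))

  +-pos : ∀ {x y} → 0# < x → 0# ≤ y → 0# < x + y
  +-pos {x} {y} 0<x 0≤y = <-≤-trans 0<x (≤-respˡ (+-identityʳ x) (+-mono-≤ ≤.refl 0≤y))

  pos⇒≉0 : ∀ {x} → 0# < x → ¬ x ≈ 0#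
  pos⇒≉0 0<x x≈0 = <⇒≉ 0<x (sym x≈0)

  inverse-pos : ∀ {x} → 0# < x → ∃[ y ] 0# < y × x * y ≈ 1#
  inverse-pos {x} 0<x with inverse x (pos⇒≉0 0<x)
  ... | y , xy≈1 = y , (λ y≤0 → 0<1 (≤-resp xy≈1 (zeroʳ x) (*-monoˡ-≤ (<⇒≤ 0<x) y≤0))) , xy≈1

  half : ∃[ h ] 0# < h × h + h ≈ 1#
  half with inverse-pos {1# + 1#} (+-pos 0<1 0≤1)
  ... | h , 0<h , 2h≈1 = h , 0<h ,
    trans (sym (trans (distribʳ h 1# 1#) (+-cong (*-identityˡ h) (*-identityˡ h)))) 2h≈1

  ≈⇒-≈0 : ∀ {x y} → x ≈ y → x - y ≈ 0#
  ≈⇒-≈0 {x} {y} x≈y = trans (+-congʳ x≈y) (-‿inverseʳ y)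

  -≈0⇒≈ : ∀ {x y} → x - y ≈ 0# → x ≈ y
  -≈0⇒≈ {x} {y} x-y≈0 = trans (solve 2 (λ x y → x := (x :- y) :+ y) refl x y)
                          (trans (+-congʳ x-y≈0) (+-identityˡ y))

  fromℤ-nonNegative : ∀ n → 0# ≤ n ×ᴷ 1#
  fromℤ-nonNegative zero    = ≤.refl
  fromℤ-nonNegative (suc n) = ≤-respˡ (+-identityˡ 0#) (+-mono-≤ 0≤1 (fromℤ-nonNegative n))

  private
    0≤⇒0≤fromℤ : ∀ {i} → ℤ.0ℤ ℤ.≤ i → 0# ≤ fromℤ i
    0≤⇒0≤fromℤ {ℤ.+ n} (ℤ.+≤+ _) = fromℤ-nonNegative n

  fromℤ-mono-≤ : ∀ {i j} → i ℤ.≤ j → fromℤ i ≤ fromℤ j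
  fromℤ-mono-≤ {i} {j} i≤j = 0≤y-x⇒x≤y (≤-respʳ
    (trans (fromℤ-+ j (ℤ.- i)) (+-congˡ (fromℤ-neg i))) (0≤⇒0≤fromℤ (ℤₚ.i≤j⇒0≤j-i i≤j)))

  fromℤ-mono-< : ∀ {i j} → i ℤ.< j → fromℤ i < fromℤ j
  fromℤ-mono-< {i} {j} i<j j≤i = 0<1 (≤-resp
    (solve 2 (λ x y → (x :+ y) :- y := x) refl 1# (fromℤ i)) (-‿inverseʳ _)
    (+-monoˡ-≤ (- fromℤ i) (≤.trans
      (≤-respˡ (trans (fromℤ-+ ℤ.1ℤ i) (+-congʳ (+-identityʳ 1#))) (fromℤ-mono-≤ (ℤₚ.i<j⇒suc[i]≤j i<j)))
      j≤i)))

  fromℤ-injective : ∀ {i j} → fromℤ i ≈ fromℤ j → i ≡ j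
  fromℤ-injective {i} {j} eq with ℤₚ.<-cmp i j
  ... | tri< i<j _ _ = contradiction eq (<⇒≉ (fromℤ-mono-< i<j))
  ... | tri≈ _ i≡j _ = i≡j
  ... | tri> _ _ j<i = contradiction (sym eq) (<⇒≉ (fromℤ-mono-< j<i))

-- Linear algebra: elimination, bases and the invariance of dimension.

module LinearAlgebra (K : OrderedField c ℓ₁ ℓ₂) where

  open import Relation.Unary using (Pred; _∈_)
  open OrderedField K hiding (zero)
  open OrderedFieldProperties K
  open Polyhedral K
  open Solver using (solve; _:+_; _:*_; _:-_; :-_; _:=_)
  open SemiringSum semiring
    using (sum-replicate-zero; ∑-distrib-+; ∑-comm; *-distribˡ-sum; *-distribʳ-sum)
  open SemiringSum semiring using (sum-cong-≋) public
  open import Relation.Binary.Reasoning.Setoid (OrderedField.setoid K)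

  private variable
    k : ℕ

  infixl 6 _+ᵥ_ _-ᵥ_
  infixr 7 _*ᵥ_

  0ᵥ : Point n
  0ᵥ _ = 0#

  _+ᵥ_ _-ᵥ_ : Point n → Point n → Point n
  (x +ᵥ y) i = x i + y i
  (x -ᵥ y) i = x i - y i

  _*ᵥ_ : Carrier → Point n → Point n
  (a *ᵥ x) i = a * x i

  sum-≈0 : {f : Vector Carrier n} → (∀ i → f i ≈ 0#) → sum f ≈ 0#
  sum-≈0 {n = n} f≈0 = trans (sum-cong-≋ f≈0) (sum-replicate-zero n)

  sum-mono-≤ : {f g : Vector Carrier n} → (∀ i → f i ≤ g i) → sum f ≤ sum g
  sum-mono-≤ {n = zero}  f≤g = ≤.refl
  sum-mono-≤ {n = suc n} f≤g = +-mono-≤ (f≤g zero) (sum-mono-≤ (λ i → f≤g (suc i)))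

  -- If one term fell short, another would have to overshoot to restore the sum. `∈-cut⁻` uses this
  -- to recover the single tight inequalities from their sum.
  sum-≈⇒≈ : {f g : Vector Carrier n} → (∀ i → f i ≤ g i) → sum f ≈ sum g → ∀ i → f i ≈ g i
  sum-≈⇒≈ {n = suc n} {f} {g} f≤g eq = λ where
      zero    → ≤.antisym (f≤g zero) (0≤y-x⇒x≤y (≤-resp (-‿inverseʳ _) lemma
                  (+-monoˡ-≤ (- sum (tail f)) (sum-mono-≤ (λ i → f≤g (suc i))))))
      (suc i) → sum-≈⇒≈ (λ i → f≤g (suc i)) (≤.antisym (sum-mono-≤ (λ i → f≤g (suc i)))
                  (0≤y-x⇒x≤y (≤-resp (-‿inverseʳ _) lemma′ (+-monoˡ-≤ (- f zero) (f≤g zero))))) i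
    where
    lemma : sum (tail g) - sum (tail f) ≈ f zero - g zero
    lemma = begin
      sum (tail g) - sum (tail f)           ≈⟨ solve 3 (λ a b c → b :- a := (c :+ b) :- (c :+ a)) refl _ _ (g zero) ⟩
      sum g - (g zero + sum (tail f))       ≈⟨ +-congʳ eq ⟨
      sum f - (g zero + sum (tail f))       ≈⟨ solve 3 (λ a b c → (b :+ a) :- (c :+ a) := b :- c) refl _ _ _ ⟩
      f zero - g zero                       ∎
    lemma′ : g zero - f zero ≈ sum (tail f) - sum (tail g)
    lemma′ = begin
      g zero - f zero                       ≈⟨ solve 3 (λ a b c → b :- a := (b :+ c) :- (a :+ c)) refl _ _ (sum (tail g)) ⟩
      sum g - (f zero + sum (tail g))       ≈⟨ +-congʳ eq ⟨
      sum f - (f zero + sum (tail g))       ≈⟨ solve 3 (λ a b c → (b :+ a) :- (b :+ c) := a :- c) refl _ _ _ ⟩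
      sum (tail f) - sum (tail g)           ∎

  sum-+ : (f g : Vector Carrier n) → sum (λ i → f i + g i) ≈ sum f + sum g
  sum-+ = ∑-distrib-+

  sum-*ˡ : ∀ a (f : Vector Carrier n) → sum (λ i → a * f i) ≈ a * sum f
  sum-*ˡ a f = sym (*-distribˡ-sum a f)

  sum-neg : (f : Vector Carrier n) → sum (λ i → - f i) ≈ - sum f
  sum-neg {n = zero}  f = sym -0≈0
  sum-neg {n = suc n} f = trans (+-congˡ (sum-neg (tail f))) (-‿+-comm _ _)

  ·-cong : {x y z w : Point n} → x ≋ y → z ≋ w → x · z ≈ y · w
  ·-cong x≋y z≋w = sum-cong-≋ (λ i → *-cong (x≋y i) (z≋w i))

  ·-congʳ : (x : Point n) {y z : Point n} → y ≋ z → x · y ≈ x · z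
  ·-congʳ x = ·-cong (λ _ → refl)

  ·-congˡ : {x y : Point n} (z : Point n) → x ≋ y → x · z ≈ y · z
  ·-congˡ z x≋y = ·-cong x≋y (λ _ → refl)

  ·-comm : (x y : Point n) → x · y ≈ y · x
  ·-comm x y = sum-cong-≋ (λ i → *-comm (x i) (y i))

  ·-+ : (x y z : Point n) → x · (y +ᵥ z) ≈ x · y + x · z
  ·-+ x y z = trans (sum-cong-≋ (λ i → distribˡ (x i) (y i) (z i))) (sum-+ (λ i → x i * y i) (λ i → x i * z i))

  ·-neg : (x y : Point n) → x · (λ i → - y i) ≈ - (x · y)
  ·-neg x y = trans (sum-cong-≋ (λ i → sym (-‿distribʳ-* (x i) (y i)))) (sum-neg (λ i → x i * y i))

  ·-- : (x y z : Point n) → x · (y -ᵥ z) ≈ x · y - x · z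
  ·-- x y z = trans (·-+ x y (λ i → - z i)) (+-congˡ (·-neg x z))

  ·-* : ∀ a (x y : Point n) → x · (a *ᵥ y) ≈ a * (x · y)
  ·-* a x y = trans (sum-cong-≋ (λ i → solve 3 (λ a x y → x :* (a :* y) := a :* (x :* y)) refl a (x i) (y i)))
                (sum-*ˡ a (λ i → x i * y i))

  +-· : (x y z : Point n) → (x +ᵥ y) · z ≈ x · z + y · z
  +-· x y z = trans (·-comm (x +ᵥ y) z) (trans (·-+ z x y) (+-cong (·-comm z x) (·-comm z y)))

  -‿· : (x y z : Point n) → (x -ᵥ y) · z ≈ x · z - y · z
  -‿· x y z = trans (·-comm (x -ᵥ y) z) (trans (·-- z x y) (+-cong (·-comm z x) (-‿cong (·-comm z y))))

  *-· : ∀ a (x y : Point n) → (a *ᵥ x) · y ≈ a * (x · y)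
  *-· a x y = trans (·-comm (a *ᵥ x) y) (trans (·-* a y x) (*-congˡ (·-comm y x)))

  ·-zero : (x : Point n) → x · 0ᵥ ≈ 0#
  ·-zero x = sum-≈0 (λ i → zeroʳ (x i))

  exchange : (a : Vector Carrier m) (A : Fin m → Fin n → Carrier) (b : Vector Carrier n) →
    sum (λ i → a i * sum (λ j → A i j * b j)) ≈ sum (λ j → sum (λ i → A i j * a i) * b j)
  exchange a A b = begin
    sum (λ i → a i * sum (λ j → A i j * b j))
      ≈⟨ sum-cong-≋ (λ i → *-distribˡ-sum (a i) (λ j → A i j * b j)) ⟩
    sum (λ i → sum (λ j → a i * (A i j * b j)))
      ≈⟨ ∑-comm (λ i j → a i * (A i j * b j)) ⟩
    sum (λ j → sum (λ i → a i * (A i j * b j)))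
      ≈⟨ sum-cong-≋ (λ j → sum-cong-≋ (λ i →
           solve 3 (λ a x b → a :* (x :* b) := x :* a :* b) refl (a i) (A i j) (b j))) ⟩
    sum (λ j → sum (λ i → A i j * a i * b j))
      ≈⟨ sum-cong-≋ (λ j → *-distribʳ-sum (b j) (λ i → A i j * a i)) ⟨
    sum (λ j → sum (λ i → A i j * a i) * b j) ∎

  ·-combination : (x : Point n) (a : Vector Carrier k) (p : Vector (Point n) k) →
    x · combination a p ≈ sum (λ i → a i * (x · p i))
  ·-combination x a p = begin
    sum (λ j → x j * sum (λ i → a i * p i j))    ≈⟨ sum-cong-≋ (λ j → *-congˡ {x j} (sum-cong-≋ (λ i → *-comm (a i) (p i j)))) ⟩
    sum (λ j → x j * sum (λ i → p i j * a i))    ≈⟨ exchange x (λ j i → p i j) a ⟩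
    sum (λ i → (p i · x) * a i)                  ≈⟨ sum-cong-≋ (λ i → trans (*-comm _ (a i)) (*-congˡ (·-comm (p i) x))) ⟩
    sum (λ i → a i * (x · p i))                  ∎

  -- Gaussian elimination on the first column.
  nontrivialSolution : m ℕ.< n → (A : Fin m → Point n) →
    ∃[ a ] (∃[ j ] ¬ a j ≈ 0#) × (∀ i → A i · a ≈ 0#)
  nontrivialSolution {zero}  {suc n} _ A = (λ _ → 1#) , (zero , λ 1≈0 → 0≉1 (sym 1≈0)) , λ ()
  nontrivialSolution {suc m} {suc n} (s≤s m<n) A with Finₚ.any? (λ i → ¬? (A i zero ≤.≟ 0#))
  ... | no  column≈0 = a , (zero , λ 1≈0 → 0≉1 (sym 1≈0)) , λ i → sum-≈0 (product≈0 i)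
    where
    a : Point (suc n)
    a zero    = 1#
    a (suc _) = 0#
    product≈0 : ∀ i j → A i j * a j ≈ 0#
    product≈0 i zero    = trans (*-identityʳ _) (decidable-stable (A i zero ≤.≟ 0#) (λ ≉0 → column≈0 (i , ≉0)))
    product≈0 i (suc j) = zeroʳ _
  ... | yes (p , pivot≉0) = a , nonzero , solves
    where
    reduced : Fin m → Point n
    -- Cross-multiplication eliminates the first unknown without division. Back-substitution then
    -- scales `b` by the pivot, which keeps a nonzero entry nonzero.
    reduced i = A p zero *ᵥ tail (A (punchIn p i)) -ᵥ A (punchIn p i) zero *ᵥ tail (A p)

    recursive = nontrivialSolution m<n reduced
    b = proj₁ recursive

    a : Point (suc n)
    a zero    = - (tail (A p) · b)
    a (suc j) = A p zero * b j

    nonzero : ∃[ j ] ¬ a j ≈ 0#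
    nonzero = let j , bj≉0 = proj₁ (proj₂ recursive) in suc j , λ aj≈0 → bj≉0 (no-zero-divisors aj≈0 pivot≉0)

    row : ∀ i → A i · a ≈ A p zero * (tail (A i) · b) - A i zero * (tail (A p) · b)
    row i = trans (+-congˡ (·-* (A p zero) (tail (A i)) b))
      (solve 4 (λ x y z w → x :* (:- y) :+ z :* w := z :* w :- x :* y) refl _ _ _ _)

    solves : ∀ i → A i · a ≈ 0#
    solves i with p Finₚ.≟ i
    ... | yes ≡.refl = trans (row p) (-‿inverseʳ _)
    ... | no  p≢i    = begin
      A i · a                                                        ≈⟨ row i ⟩
      A p zero * (tail (A i) · b) - A i zero * (tail (A p) · b)      ≈⟨ +-cong (*-· _ (tail (A i)) b) (-‿cong (*-· _ (tail (A p)) b)) ⟨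
      (A p zero *ᵥ tail (A i)) · b - (A i zero *ᵥ tail (A p)) · b    ≈⟨ -‿· (A p zero *ᵥ tail (A i)) (A i zero *ᵥ tail (A p)) b ⟨
      (A p zero *ᵥ tail (A i) -ᵥ A i zero *ᵥ tail (A p)) · b
        ≡⟨ ≡.cong (λ i → (A p zero *ᵥ tail (A i) -ᵥ A i zero *ᵥ tail (A p)) · b) (Finₚ.punchIn-punchOut p≢i) ⟨
      reduced (punchOut p≢i) · b                                     ≈⟨ proj₂ (proj₂ recursive) (punchOut p≢i) ⟩
      0#                                                             ∎

  LinearlyIndependent : Vector (Point n) k → Set _
  LinearlyIndependent {k = k} d = (a : Vector Carrier k) → combination a d ≋ 0ᵥ → ∀ j → a j ≈ 0#

  Spans : Vector (Point n) k → Point n → Set _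
  Spans d x = ∃[ a ] combination a d ≋ x

  -- Together with `x` these are `suc n` columns in `n` rows, hence related; independence of `d`
  -- makes the coefficient of `x` nonzero, so the relation can be solved for `x`.
  basis-spans : (d : Vector (Point n) n) → LinearlyIndependent d → ∀ x → Spans d x
  basis-spans {n = n} d independent x = b , spans
    where
    A : Fin n → Point (suc n)
    A i zero    = x i
    A i (suc j) = d j i

    relation = nontrivialSolution ℕₚ.≤-refl A
    a = proj₁ relation

    a₀≉0 : ¬ a zero ≈ 0#
    a₀≉0 a₀≈0 = let j , aj≉0 = proj₁ (proj₂ relation) in aj≉0 (a≈0 j)
      where
      a≈0 : ∀ j → a j ≈ 0#
      a≈0 zero    = a₀≈0
      a≈0 (suc j) = independent (tail a) (λ i → begin
        sum (λ j → a (suc j) * d j i)                    ≈⟨ sum-cong-≋ (λ j → *-comm (a (suc j)) (d j i)) ⟩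
        sum (λ j → d j i * a (suc j))                    ≈⟨ +-identityˡ _ ⟨
        0# + sum (λ j → d j i * a (suc j))               ≈⟨ +-congʳ (trans (*-congˡ a₀≈0) (zeroʳ (x i))) ⟨
        x i * a zero + sum (λ j → d j i * a (suc j))     ≈⟨ proj₂ (proj₂ relation) i ⟩
        0#                                               ∎) j

    a₀⁻¹ = proj₁ (inverse (a zero) a₀≉0)

    b : Vector Carrier n
    b j = - a₀⁻¹ * a (suc j)

    spans : combination b d ≋ x
    spans i = begin
      sum (λ j → - a₀⁻¹ * a (suc j) * d j i)          ≈⟨ sum-cong-≋ (λ j → solve 3 (λ u v w → u :* v :* w := u :* (w :* v)) refl (- a₀⁻¹) (a (suc j)) (d j i)) ⟩
      sum (λ j → - a₀⁻¹ * (d j i * a (suc j)))        ≈⟨ sum-*ˡ (- a₀⁻¹) (λ j → d j i * a (suc j)) ⟩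
      - a₀⁻¹ * s                                      ≈⟨ solve 4 (λ u x y s → (:- u) :* s := (y :* u) :* x :- u :* (x :* y :+ s)) refl a₀⁻¹ (x i) (a zero) s ⟩
      (a zero * a₀⁻¹) * x i - a₀⁻¹ * (x i * a zero + s)   ≈⟨ +-cong (*-congʳ (proj₂ (inverse (a zero) a₀≉0))) (-‿cong (*-congˡ (proj₂ (proj₂ relation) i))) ⟩
      1# * x i - a₀⁻¹ * 0#                            ≈⟨ +-cong (*-identityˡ (x i)) (trans (-‿cong (zeroʳ a₀⁻¹)) -0≈0) ⟩
      x i + 0#                                        ≈⟨ +-identityʳ (x i) ⟩
      x i                                             ∎
      where s = sum (λ j → d j i * a (suc j))

  -- If there were more points `q` than points `p`, the coefficients that express the former through
  -- the latter would have a nontrivial relation, and it would be an affine relation between the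
  -- `q j`.
  affinelyIndependent-≤ : ∀ {a b} (p : Vector (Point n) (suc a)) (q : Vector (Point n) (suc b)) →
    AffinelyIndependent q → (∀ j → q j ∈ AffineHull p) → b ℕ.≤ a
  affinelyIndependent-≤ {n} {a} {b} p q independent hull = ℕₚ.≮⇒≥ λ a<b →
    let α , (j , αj≉0) , relation = nontrivialSolution (s≤s a<b) A
        -- Taking `v` to be 1 gives the sum of the weights, as each row of `C` sums to one; taking a
        -- coordinate of `p` gives the combination of the `q j`.
        collapse : ∀ v → sum (λ j → α j * sum (λ i → C j i * v i)) ≈ 0#
        collapse v = trans (exchange α C v) (sum-≈0 (λ i → trans (*-congʳ (relation i)) (zeroˡ (v i))))
    in αj≉0 (independent α
         (begin
           sum α                                           ≈⟨ sum-cong-≋ (λ j → begin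
             α j                                             ≈⟨ *-identityʳ (α j) ⟨
             α j * 1#                                        ≈⟨ *-congˡ (proj₁ (proj₂ (hull j))) ⟨
             α j * sum (C j)                                 ≈⟨ *-congˡ (sum-cong-≋ (λ i → *-identityʳ (C j i))) ⟨
             α j * sum (λ i → C j i * 1#)                    ∎) ⟩
           sum (λ j → α j * sum (λ i → C j i * 1#))        ≈⟨ collapse (λ _ → 1#) ⟩
           0#                                              ∎)
         (λ t → begin
           sum (λ j → α j * q j t)                               ≈⟨ sum-cong-≋ (λ j → *-congˡ {α j} (proj₂ (proj₂ (hull j)) t)) ⟨
           sum (λ j → α j * sum (λ i → C j i * p i t))           ≈⟨ collapse (λ i → p i t) ⟩
           0#                                                    ∎) j)
    where
    C : Fin (suc b) → Fin (suc a) → Carrier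
    C j = proj₁ (hull j)
    A : Fin (suc a) → Point (suc b)
    A i j = C j i

  dimension-mono : ∀ {ℓ ℓ′} {S : Pred (Point n) ℓ} {T : Pred (Point n) ℓ′} {a b} →
    (∀ x → x ∈ S → x ∈ T) → HasDimension S a → HasDimension T b → a ℕ.≤ b
  dimension-mono S⊆T (q , q∈S , q-independent , _) (p , _ , _ , p-hull) =
    affinelyIndependent-≤ p q q-independent (λ j → p-hull (q j) (S⊆T (q j) (q∈S j)))

  dimension-unique : ∀ {ℓ} {S : Pred (Point n) ℓ} {a b} → HasDimension S a → HasDimension S b → a ≡ b
  dimension-unique S-a S-b = ℕₚ.≤-antisym (dimension-mono (λ _ x∈S → x∈S) S-a S-b) (dimension-mono (λ _ x∈S → x∈S) S-b S-a)

-- Faces of a polytope: dimension, relative interior, edges and vertices.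

module Faces (K : OrderedField c ℓ₁ ℓ₂) where

  open import Relation.Unary using (Pred; _∈_)
  open OrderedField K hiding (zero)
  open OrderedFieldProperties K
  open Polyhedral K
  open LinearAlgebra K
  open Solver using (solve; _:+_; _:*_; _:-_; :-_; _:=_)
  open import Relation.Binary.Reasoning.Setoid (OrderedField.setoid K)

  private variable
    k : ℕ

  -- A whole interval above 0 is required, not a single value, so that finitely many such conditions
  -- can be met by one `ε`.
  HoldsForSmall : Pred Carrier ℓ → Set _
  HoldsForSmall Q = ∃[ ε ] 0# < ε × (∀ δ → 0# < δ → δ ≤ ε → Q δ)

  holdsForSmall-all : {Q : Fin k → Pred Carrier ℓ} →
    (∀ i → HoldsForSmall (Q i)) → HoldsForSmall (λ ε → ∀ i → Q i ε)
  holdsForSmall-all {k = zero}  h = 1# , 0<1 , λ _ _ _ ()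
  holdsForSmall-all {k = suc k} h with h zero | holdsForSmall-all (h ∘ suc)
  ... | ε₁ , 0<ε₁ , h₁ | ε₂ , 0<ε₂ , h₂ with ≤.total ε₁ ε₂
  ...   | inj₁ ε₁≤ε₂ = ε₁ , 0<ε₁ , λ where
    δ 0<δ δ≤ε₁ zero    → h₁ δ 0<δ δ≤ε₁
    δ 0<δ δ≤ε₁ (suc i) → h₂ δ 0<δ (≤.trans δ≤ε₁ ε₁≤ε₂) i
  ...   | inj₂ ε₂≤ε₁ = ε₂ , 0<ε₂ , λ where
    δ 0<δ δ≤ε₂ zero    → h₁ δ 0<δ (≤.trans δ≤ε₂ ε₂≤ε₁)
    δ 0<δ δ≤ε₂ (suc i) → h₂ δ 0<δ δ≤ε₂ i

  witness : {Q : Pred Carrier ℓ} → HoldsForSmall Q → ∃[ ε ] 0# < ε × Q ε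
  witness (ε , 0<ε , small) = ε , 0<ε , small ε 0<ε ≤.refl

  -- The ratio test for an inequality with slack `s` that is consumed at rate `a`: a positive rate
  -- forces a positive slack, and `s * a⁻¹` is then the longest admissible step.
  scaled-≤ : ∀ {a s} → 0# ≤ s → (s ≈ 0# → a ≤ 0#) → HoldsForSmall (λ ε → ε * a ≤ s)
  scaled-≤ {a} {s} 0≤s s≈0⇒a≤0 with a ≤.≤? 0#
  ... | yes a≤0 = 1# , 0<1 , λ δ 0<δ _ →
    ≤.trans (≤-respʳ (zeroʳ δ) (*-monoˡ-≤ (<⇒≤ 0<δ) a≤0)) 0≤s
  ... | no  0<a = s * a⁻¹ , *-pos 0<s 0<a⁻¹ , λ δ _ δ≤sa⁻¹ →
    ≤-resp (*-comm a δ)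
      (begin a * (s * a⁻¹)   ≈⟨ solve 3 (λ a s b → a :* (s :* b) := (a :* b) :* s) refl a s a⁻¹ ⟩
             (a * a⁻¹) * s   ≈⟨ *-congʳ aa⁻¹≈1 ⟩
             1# * s          ≈⟨ *-identityˡ s ⟩
             s               ∎)
      (*-monoˡ-≤ (<⇒≤ 0<a) δ≤sa⁻¹)
    where
    a⁻¹ = proj₁ (inverse-pos 0<a)
    0<a⁻¹ = proj₁ (proj₂ (inverse-pos 0<a))
    aa⁻¹≈1 = proj₂ (proj₂ (inverse-pos 0<a))
    0<s : 0# < s
    0<s = ≤∧≉⇒< 0≤s (λ 0≈s → 0<a (s≈0⇒a≤0 (sym 0≈s)))

  unit : Fin n → Point n
  unit zero    zero    = 1#
  unit zero    (suc i) = 0#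
  unit (suc j) zero    = 0#
  unit (suc j) (suc i) = unit j i

  unit-· : ∀ j (x : Point n) → unit j · x ≈ x j
  unit-· zero    x = trans (+-cong (*-identityˡ _) (sum-≈0 (λ i → zeroˡ (x (suc i))))) (+-identityʳ _)
  unit-· (suc j) x = trans (+-cong (zeroˡ _) (unit-· j (tail x))) (+-identityˡ _)

  combination-unit : (a : Point n) → combination a unit ≋ a
  combination-unit a zero    = trans (+-cong (*-identityʳ _) (sum-≈0 (λ i → zeroʳ (a (suc i))))) (+-identityʳ _)
  combination-unit a (suc i) = trans (+-cong (zeroʳ _) (combination-unit (tail a) i)) (+-identityˡ _)

  -- The frame is `p` and the points `p +ᵥ ε *ᵥ d j`. By `combination-q`, total weight 0 leaves `ε`
  -- times a combination of directions, which reduces affine to linear independence; total weight 1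
  -- leaves `p` plus such a combination, which gives the hull.
  dimension-from-directions : {S : Pred (Point n) ℓ} (p : Point n) (d : Vector (Point n) k) →
    p ∈ S → (∃[ ε ] 0# < ε × (∀ j → p +ᵥ ε *ᵥ d j ∈ S)) →
    LinearlyIndependent d → (∀ x → x ∈ S → Spans d (x -ᵥ p)) → HasDimension S k
  dimension-from-directions {n = n} {k = k} {S} p d p∈S (ε , 0<ε , q∈S) independent spans =
    q , (λ { zero → p∈S ; (suc j) → q∈S j }) , affinelyIndependent , hull
    where
    q : Vector (Point n) (suc k)
    q zero    = p
    q (suc j) = p +ᵥ ε *ᵥ d j

    combination-q : ∀ a → combination a q ≋ sum a *ᵥ p +ᵥ ε *ᵥ combination (tail a) d
    combination-q a i = begin
      a zero * p i + sum (λ j → a (suc j) * (p i + ε * d j i))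
        ≈⟨ +-congˡ (trans (sum-cong-≋ (λ j → solve 4 (λ a p e d → a :* (p :+ e :* d) := p :* a :+ e :* (a :* d)) refl (a (suc j)) (p i) ε (d j i)))
             (trans (sum-+ (λ j → p i * a (suc j)) (λ j → ε * (a (suc j) * d j i)))
               (+-cong (sum-*ˡ (p i) (tail a)) (sum-*ˡ ε (λ j → a (suc j) * d j i))))) ⟩
      a zero * p i + (p i * sum (tail a) + ε * combination (tail a) d i)
        ≈⟨ solve 4 (λ a p s r → a :* p :+ (p :* s :+ r) := (a :+ s) :* p :+ r) refl (a zero) (p i) (sum (tail a)) _ ⟩
      sum a * p i + ε * combination (tail a) d i ∎

    affinelyIndependent : AffinelyIndependent q
    affinelyIndependent a Σa≈0 aq≈0 = λ { zero → a₀≈0 ; (suc j) → tail≈0 j }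
      where
      tail≈0 : ∀ j → a (suc j) ≈ 0#
      tail≈0 = independent (tail a) (λ i → no-zero-divisors (begin
        ε * combination (tail a) d i                  ≈⟨ +-identityˡ _ ⟨
        0# + ε * combination (tail a) d i             ≈⟨ +-congʳ (trans (*-congʳ Σa≈0) (zeroˡ (p i))) ⟨
        sum a * p i + ε * combination (tail a) d i    ≈⟨ combination-q a i ⟨
        combination a q i                             ≈⟨ aq≈0 i ⟩
        0#                                            ∎) (pos⇒≉0 0<ε))
      a₀≈0 : a zero ≈ 0#
      a₀≈0 = begin
        a zero                   ≈⟨ +-identityʳ _ ⟨
        a zero + 0#              ≈⟨ +-congˡ (sum-≈0 tail≈0) ⟨
        sum a                    ≈⟨ Σa≈0 ⟩
        0#                       ∎

    hull : ∀ x → x ∈ S → x ∈ AffineHull q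
    hull x x∈S = a , Σa≈1 , λ i → begin
      combination a q i                             ≈⟨ combination-q a i ⟩
      sum a * p i + ε * combination (tail a) d i    ≈⟨ +-cong (trans (*-congʳ Σa≈1) (*-identityˡ (p i))) (scaled i) ⟩
      p i + (x i - p i)                             ≈⟨ solve 2 (λ x p → p :+ (x :- p) := x) refl (x i) (p i) ⟩
      x i                                           ∎
      where
      b = proj₁ (spans x x∈S)
      ε⁻¹ = proj₁ (inverse-pos 0<ε)
      a : Vector Carrier (suc k)
      a zero    = 1# - sum (λ j → ε⁻¹ * b j)
      a (suc j) = ε⁻¹ * b j
      Σa≈1 : sum a ≈ 1#
      Σa≈1 = solve 2 (λ x y → (x :- y) :+ y := x) refl 1# (sum (λ j → ε⁻¹ * b j))
      scaled : ∀ i → ε * combination (tail a) d i ≈ x i - p i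
      scaled i = begin
        ε * sum (λ j → ε⁻¹ * b j * d j i)      ≈⟨ *-congˡ (sum-cong-≋ (λ j → *-assoc ε⁻¹ (b j) (d j i))) ⟩
        ε * sum (λ j → ε⁻¹ * (b j * d j i))    ≈⟨ *-congˡ (sum-*ˡ ε⁻¹ (λ j → b j * d j i)) ⟩
        ε * (ε⁻¹ * combination b d i)          ≈⟨ *-assoc ε ε⁻¹ _ ⟨
        ε * ε⁻¹ * combination b d i            ≈⟨ *-congʳ (proj₂ (proj₂ (inverse-pos 0<ε))) ⟩
        1# * combination b d i                 ≈⟨ *-identityˡ _ ⟩
        combination b d i                      ≈⟨ proj₂ (spans x x∈S) i ⟩
        x i - p i                              ∎

  module HyperplaneDirections (q : Point (suc n)) (q₀≉0 : ¬ q zero ≈ 0#) where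

    -- The basis `q₀ eⱼ − qⱼ e₀` of the kernel of `q`. Outside the first coordinate it is `q₀` times
    -- the standard basis, hence independent; the first coordinate of a kernel vector is determined
    -- by the others.
    along : Vector (Point (suc n)) n
    along j zero    = - q (suc j)
    along j (suc i) = q zero * unit j i

    normal-· : ∀ j → q · along j ≈ 0#
    normal-· j = begin
      q zero * - q (suc j) + tail q · (q zero *ᵥ unit j)   ≈⟨ +-congˡ (trans (·-* (q zero) (tail q) (unit j)) (*-congˡ (trans (·-comm (tail q) (unit j)) (unit-· j (tail q))))) ⟩
      q zero * - q (suc j) + q zero * q (suc j)            ≈⟨ distribˡ (q zero) _ _ ⟨
      q zero * (- q (suc j) + q (suc j))                   ≈⟨ *-congˡ (-‿inverseˡ _) ⟩
      q zero * 0#                                          ≈⟨ zeroʳ _ ⟩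
      0#                                                   ∎

    combination-along : ∀ a j → combination a along (suc j) ≈ q zero * a j
    combination-along a j = begin
      sum (λ i → a i * (q zero * unit i j))    ≈⟨ sum-cong-≋ (λ i → solve 3 (λ a q u → a :* (q :* u) := q :* (a :* u)) refl (a i) (q zero) (unit i j)) ⟩
      sum (λ i → q zero * (a i * unit i j))    ≈⟨ sum-*ˡ (q zero) (λ i → a i * unit i j) ⟩
      q zero * combination a unit j            ≈⟨ *-congˡ (combination-unit a j) ⟩
      q zero * a j                             ∎

    along-independent : LinearlyIndependent along
    along-independent a ad≈0 j = no-zero-divisors (trans (sym (combination-along a j)) (ad≈0 (suc j))) q₀≉0

    along-spans : ∀ z → q · z ≈ 0# → Spans along z
    along-spans z q·z≈0 with inverse (q zero) q₀≉0
    ... | q₀⁻¹ , qq⁻¹≈1 = a , λ where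
        zero → begin
          sum (λ j → q₀⁻¹ * z (suc j) * - q (suc j))            ≈⟨ sum-cong-≋ (λ j → solve 3 (λ a z q → a :* z :* :- q := :- a :* (q :* z)) refl q₀⁻¹ (z (suc j)) (q (suc j))) ⟩
          sum (λ j → - q₀⁻¹ * (q (suc j) * z (suc j)))          ≈⟨ sum-*ˡ (- q₀⁻¹) (λ j → q (suc j) * z (suc j)) ⟩
          - q₀⁻¹ * s                                            ≈⟨ solve 4 (λ a q z s → :- a :* s := (q :* a) :* z :- a :* (q :* z :+ s)) refl q₀⁻¹ (q zero) (z zero) s ⟩
          q zero * q₀⁻¹ * z zero - q₀⁻¹ * (q zero * z zero + s) ≈⟨ +-cong (trans (*-congʳ qq⁻¹≈1) (*-identityˡ _)) (-‿cong (trans (*-congˡ q·z≈0) (zeroʳ _))) ⟩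
          z zero - 0#                                           ≈⟨ trans (+-congˡ -0≈0) (+-identityʳ _) ⟩
          z zero                                                ∎
        (suc j) → begin
          combination a along (suc j)      ≈⟨ combination-along a j ⟩
          q zero * (q₀⁻¹ * z (suc j))      ≈⟨ *-assoc _ _ _ ⟨
          q zero * q₀⁻¹ * z (suc j)        ≈⟨ *-congʳ qq⁻¹≈1 ⟩
          1# * z (suc j)                   ≈⟨ *-identityˡ _ ⟩
          z (suc j)                        ∎
      where
      s = tail q · tail z
      a : Vector Carrier n
      a j = q₀⁻¹ * z (suc j)

  -- The functionals vanishing on x − p are generated by δₜ eⱼ − δⱼ eₜ, where δ = x − p and δₜ ≠ 0.
  segment-dimension : {S : Pred (Point n) ℓ} {p x : Point n} → p ∈ S → (∀ {y z} → y ≋ z → y ∈ S → z ∈ S) →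
    x ∈ S → ¬ x ≋ p → (∀ d → d · x ≈ d · p → ∀ y → y ∈ S → d · y ≈ d · p) → HasDimension S 1
  segment-dimension {n} {S = S} {p} {x} p∈S resp x∈S x≉p constant =
    let t , δₜ≉0 = Finₚ.¬∀⟶∃¬ n (λ t → δ t ≈ 0#) (λ t → δ t ≤.≟ 0#) (λ δ≈0 → x≉p (λ j → -≈0⇒≈ (δ≈0 j)))
    in dimension-from-directions p (λ _ → δ) p∈S (1# , 0<1 , λ _ → resp x-reached x∈S)
         (independent t δₜ≉0) (spans t δₜ≉0)
    where
    δ : Point n
    δ = x -ᵥ p

    x-reached : x ≋ p +ᵥ 1# *ᵥ δ
    x-reached j = sym (trans (+-congˡ (*-identityˡ (δ j)))
      (solve 2 (λ p x → p :+ (x :- p) := x) refl (p j) (x j)))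

    independent : ∀ t → ¬ δ t ≈ 0# → LinearlyIndependent (λ (_ : Fin 1) → δ)
    independent t δₜ≉0 a aδ≈0 zero = no-zero-divisors
      (trans (*-comm (δ t) (a zero)) (trans (sym (+-identityʳ _)) (aδ≈0 t))) δₜ≉0

    module _ (t : Fin n) (j : Fin n) where
      d : Point n
      d = δ t *ᵥ unit j -ᵥ δ j *ᵥ unit t

      d-· : ∀ y → d · y ≈ δ t * y j - δ j * y t
      d-· y = trans (-‿· (δ t *ᵥ unit j) (δ j *ᵥ unit t) y) (+-cong
        (trans (*-· (δ t) (unit j) y) (*-congˡ (unit-· j y)))
        (-‿cong (trans (*-· (δ j) (unit t) y) (*-congˡ (unit-· t y)))))

      d-constant : d · x ≈ d · p
      d-constant = trans (d-· x) (trans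
        (solve 4 (λ a b c d → (b :- d) :* a :- (a :- c) :* b := (b :- d) :* c :- (a :- c) :* d) refl (x j) (x t) (p j) (p t))
        (sym (d-· p)))

      parallel : ∀ y → y ∈ S → δ t * (y j - p j) ≈ δ j * (y t - p t)
      parallel y y∈S = -≈0⇒≈ (trans
        (solve 6 (λ a b y p y′ p′ → a :* (y :- p) :- b :* (y′ :- p′) := (a :* y :- b :* y′) :- (a :* p :- b :* p′))
          refl (δ t) (δ j) (y j) (p j) (y t) (p t))
        (≈⇒-≈0 (trans (sym (d-· y)) (trans (constant d d-constant y y∈S) (d-· p)))))

    spans : ∀ t → ¬ δ t ≈ 0# → ∀ y → y ∈ S → Spans (λ (_ : Fin 1) → δ) (y -ᵥ p)
    spans t δₜ≉0 y y∈S with inverse (δ t) δₜ≉0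
    ... | δₜ⁻¹ , δₜδₜ⁻¹≈1 = (λ _ → δₜ⁻¹ * (y t - p t)) , λ j → begin
      δₜ⁻¹ * (y t - p t) * δ j + 0#      ≈⟨ +-identityʳ _ ⟩
      δₜ⁻¹ * (y t - p t) * δ j           ≈⟨ solve 3 (λ a x d → a :* x :* d := a :* (d :* x)) refl δₜ⁻¹ (y t - p t) (δ j) ⟩
      δₜ⁻¹ * (δ j * (y t - p t))         ≈⟨ *-congˡ (parallel t j y y∈S) ⟨
      δₜ⁻¹ * (δ t * (y j - p j))         ≈⟨ solve 3 (λ a x d → a :* (d :* x) := d :* a :* x) refl δₜ⁻¹ (y j - p j) (δ t) ⟩
      δ t * δₜ⁻¹ * (y j - p j)           ≈⟨ *-congʳ δₜδₜ⁻¹≈1 ⟩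
      1# * (y j - p j)                   ≈⟨ *-identityˡ _ ⟩
      y j - p j                          ∎

  hull-value : ∀ (d : Point n) {b} (p : Vector (Point n) k) x → (∀ j → d · p j ≈ b) → x ∈ AffineHull p → d · x ≈ b
  hull-value d {b} p x constant (a , Σa≈1 , eq) = begin
    d · x                              ≈⟨ ·-congʳ d (λ j → sym (eq j)) ⟩
    d · combination a p                ≈⟨ ·-combination d a p ⟩
    sum (λ j → a j * (d · p j))        ≈⟨ sum-cong-≋ (λ j → trans (*-congˡ (constant j)) (*-comm (a j) b)) ⟩
    sum (λ j → b * a j)                ≈⟨ sum-*ˡ b a ⟩
    b * sum a                          ≈⟨ *-congˡ Σa≈1 ⟩
    b * 1#                             ≈⟨ *-identityʳ b ⟩
    b                                  ∎

  -- The hyperplane misses the origin, so a linear relation between points of it is an affine one.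
  hyperplane-hull : ∀ (q : Point n) {o} → ¬ o ≈ 0# → (p : Vector (Point n) n) → AffinelyIndependent p →
    (∀ j → q · p j ≈ o) → ∀ x → q · x ≈ o → x ∈ AffineHull p
  hyperplane-hull {n} q {o} o≉0 p independent on x x-on
    with nontrivialSolution ℕₚ.≤-refl (λ t → λ { zero → x t ; (suc j) → p j t })
  ... | a , (l , aₗ≉0) , relation = conclude (inverse (a zero) a₀≉0)
    where
    rest : Point n
    rest t = sum (λ j → p j t * a (suc j))

    combination-rest : combination (tail a) p ≋ rest
    combination-rest t = sum-cong-≋ (λ j → *-comm (a (suc j)) (p j t))

    q·rest : q · rest ≈ o * sum (tail a)
    q·rest = begin
      q · rest                                  ≈⟨ ·-congʳ q combination-rest ⟨
      q · combination (tail a) p                ≈⟨ ·-combination q (tail a) p ⟩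
      sum (λ j → a (suc j) * (q · p j))         ≈⟨ sum-cong-≋ (λ j → trans (*-congˡ (on j)) (*-comm (a (suc j)) o)) ⟩
      sum (λ j → o * a (suc j))                 ≈⟨ sum-*ˡ o (tail a) ⟩
      o * sum (tail a)                          ∎

    Σa≈0 : sum a ≈ 0#
    Σa≈0 = no-zero-divisors (begin
      o * (a zero + sum (tail a))                         ≈⟨ solve 3 (λ o a s → o :* (a :+ s) := a :* o :+ o :* s) refl o (a zero) (sum (tail a)) ⟩
      a zero * o + o * sum (tail a)                       ≈⟨ +-cong (*-congˡ x-on) q·rest ⟨
      a zero * (q · x) + q · rest                         ≈⟨ +-congʳ (·-* (a zero) q x) ⟨
      q · (a zero *ᵥ x) + q · rest                        ≈⟨ ·-+ q (a zero *ᵥ x) rest ⟨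
      q · (a zero *ᵥ x +ᵥ rest)                           ≈⟨ ·-congʳ q (λ t → trans (+-congʳ (*-comm (a zero) (x t))) (relation t)) ⟩
      q · 0ᵥ                                              ≈⟨ ·-zero q ⟩
      0#                                                  ∎) o≉0

    a₀≉0 : ¬ a zero ≈ 0#
    a₀≉0 a₀≈0 = aₗ≉0 (a≈0 l)
      where
      a≈0 : ∀ j → a j ≈ 0#
      a≈0 zero    = a₀≈0
      a≈0 (suc j) = independent (tail a)
        (trans (sym (trans (+-congʳ a₀≈0) (+-identityˡ _))) Σa≈0)
        (λ t → trans (combination-rest t)
          (trans (sym (trans (+-congʳ (trans (*-congˡ a₀≈0) (zeroʳ (x t)))) (+-identityˡ _))) (relation t))) j

    conclude : ∃[ a₀⁻¹ ] a zero * a₀⁻¹ ≈ 1# → x ∈ AffineHull p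
    conclude (a₀⁻¹ , a₀a₀⁻¹≈1) = (λ j → - a₀⁻¹ * a (suc j))
      , (begin
          sum (λ j → - a₀⁻¹ * a (suc j))              ≈⟨ sum-*ˡ (- a₀⁻¹) (tail a) ⟩
          - a₀⁻¹ * sum (tail a)                       ≈⟨ solve 3 (λ u s a → :- u :* s := a :* u :- u :* (a :+ s)) refl a₀⁻¹ (sum (tail a)) (a zero) ⟩
          a zero * a₀⁻¹ - a₀⁻¹ * sum a                ≈⟨ +-cong a₀a₀⁻¹≈1 (-‿cong (trans (*-congˡ Σa≈0) (zeroʳ a₀⁻¹))) ⟩
          1# - 0#                                     ≈⟨ trans (+-congˡ -0≈0) (+-identityʳ 1#) ⟩
          1#                                          ∎)
      , λ t → begin
          sum (λ j → - a₀⁻¹ * a (suc j) * p j t)            ≈⟨ sum-cong-≋ (λ j → *-assoc (- a₀⁻¹) (a (suc j)) (p j t)) ⟩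
          sum (λ j → - a₀⁻¹ * (a (suc j) * p j t))          ≈⟨ sum-*ˡ (- a₀⁻¹) (λ j → a (suc j) * p j t) ⟩
          - a₀⁻¹ * combination (tail a) p t                 ≈⟨ *-congˡ (combination-rest t) ⟩
          - a₀⁻¹ * rest t                                   ≈⟨ solve 4 (λ u s a x → :- u :* s := (a :* u) :* x :- u :* (x :* a :+ s)) refl a₀⁻¹ (rest t) (a zero) (x t) ⟩
          a zero * a₀⁻¹ * x t - a₀⁻¹ * (x t * a zero + rest t)  ≈⟨ +-cong (trans (*-congʳ a₀a₀⁻¹≈1) (*-identityˡ (x t))) (-‿cong (trans (*-congˡ (relation t)) (zeroʳ a₀⁻¹))) ⟩
          x t - 0#                                          ≈⟨ trans (+-congˡ -0≈0) (+-identityʳ (x t)) ⟩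
          x t                                               ∎

  private
    h = proj₁ half
    0<h : 0# < h
    0<h = proj₁ (proj₂ half)
    h+h≈1 : h + h ≈ 1#
    h+h≈1 = proj₂ (proj₂ half)

    halves : ∀ x → h * x + h * x ≈ x
    halves x = trans (sym (distribʳ x h h)) (trans (*-congʳ h+h≈1) (*-identityˡ x))

  midpoint : Point n → Point n → Point n
  midpoint x y = h *ᵥ x +ᵥ h *ᵥ y

  ·-midpoint : (d x y : Point n) → d · midpoint x y ≈ h * (d · x) + h * (d · y)
  ·-midpoint d x y = trans (·-+ d (h *ᵥ x) (h *ᵥ y)) (+-cong (·-* h d x) (·-* h d y))

  module _ (d : Point n) {o : Carrier} {x y : Point n} (x≤ : d · x ≤ o) (y≤ : d · y ≤ o) where

    midpoint-≤ : d · midpoint x y ≤ o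
    midpoint-≤ = ≤-resp (sym (·-midpoint d x y)) (halves o)
      (+-mono-≤ (*-monoˡ-≤ (<⇒≤ 0<h) x≤) (*-monoˡ-≤ (<⇒≤ 0<h) y≤))

    midpoint-≈ˡ : d · midpoint x y ≈ o → d · x ≈ o
    midpoint-≈ˡ eq = ≤.antisym x≤ (*-cancelˡ-≤ 0<h (0≤y-x⇒x≤y (≤-resp (-‿inverseʳ (h * (d · y)))
      (begin
        h * o - h * (d · y)                                          ≈⟨ solve 2 (λ a b → a :- b := (a :+ a) :- (a :+ b)) refl (h * o) (h * (d · y)) ⟩
        (h * o + h * o) - (h * o + h * (d · y))                      ≈⟨ +-congʳ (trans (halves o) (trans (sym eq) (·-midpoint d x y))) ⟩
        (h * (d · x) + h * (d · y)) - (h * o + h * (d · y))          ≈⟨ solve 3 (λ a b c → (c :+ b) :- (a :+ b) := c :- a) refl (h * o) (h * (d · y)) (h * (d · x)) ⟩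
        h * (d · x) - h * o                                          ∎)
      (+-monoˡ-≤ (- (h * (d · y))) (*-monoˡ-≤ (<⇒≤ 0<h) y≤)))))

  midpoint-≈ : (d : Point n) {o : Carrier} {x y : Point n} → d · x ≈ o → d · y ≈ o → d · midpoint x y ≈ o
  midpoint-≈ d {o} {x} {y} x≈ y≈ = trans (·-midpoint d x y) (trans (+-cong (*-congˡ x≈) (*-congˡ y≈)) (halves o))

  midpoint-comm : (x y : Point n) → midpoint x y ≋ midpoint y x
  midpoint-comm x y i = +-comm _ _

  midpoint-≈ʳ : (d : Point n) {o : Carrier} {x y : Point n} →
    d · x ≤ o → d · y ≤ o → d · midpoint x y ≈ o → d · y ≈ o
  midpoint-≈ʳ d {x = x} {y} x≤ y≤ eq = midpoint-≈ˡ d y≤ x≤ (trans (·-congʳ d (midpoint-comm y x)) eq)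

  module _ (P : Polytope n) where
    open Polytope P using (size; normal; offset)

    Tight Strict : Fin size → Point n → Set _
    Tight i x = normal i · x ≈ offset i
    Strict i x = normal i · x < offset i

    tight? : ∀ i x → Dec (Tight i x)
    tight? i x = normal i · x ≤.≟ offset i

    facetOf : Fin size → Face P
    facetOf i = record { direction = normal i ; value = offset i ; valid = λ x x∈P → x∈P i }

    -- A `Face` needs a single functional, so an intersection of facets is exposed by adding their
    -- inequalities: the sum is tight exactly where every chosen one is.
    cut : (Fin size → Bool) → Face P
    cut S = record
      { direction = combination coefficient normal
      ; value = sum (λ i → coefficient i * offset i)
      ; valid = λ x x∈P → ≤-respˡ (sym (direction-· x)) (sum-mono-≤ (bound x x∈P)) }
      where
      coefficient : Fin size → Carrier
      coefficient i = if S i then 1# else 0#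
      0≤coefficient : ∀ i → 0# ≤ coefficient i
      0≤coefficient i with S i
      ... | true  = 0≤1
      ... | false = ≤.refl
      direction-· : ∀ x → combination coefficient normal · x ≈ sum (λ i → coefficient i * (normal i · x))
      direction-· x = trans (·-comm (combination coefficient normal) x)
        (trans (·-combination x coefficient normal) (sum-cong-≋ (λ i → *-congˡ (·-comm x (normal i)))))
      bound : ∀ x → x ∈ points P → ∀ i → coefficient i * (normal i · x) ≤ coefficient i * offset i
      bound x x∈P i = *-monoˡ-≤ (0≤coefficient i) (x∈P i)

    ∈-cut⁺ : ∀ S {x} → x ∈ points P → (∀ i → S i ≡ true → Tight i x) → x ∈ facePoints {P = P} (cut S)
    ∈-cut⁺ S {x} x∈P tight = x∈P , trans (·-comm _ x) (trans (·-combination x _ normal)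
      (sum-cong-≋ (λ i → trans (*-congˡ (·-comm x (normal i))) (eq i))))
      where
      eq : ∀ i → (if S i then 1# else 0#) * (normal i · x) ≈ (if S i then 1# else 0#) * offset i
      eq i with S i in Si
      ... | true  = *-congˡ (tight i Si)
      ... | false = trans (zeroˡ _) (sym (zeroˡ _))

    ∈-cut⁻ : ∀ S {x} → x ∈ facePoints {P = P} (cut S) → ∀ i → S i ≡ true → Tight i x
    ∈-cut⁻ S {x} (x∈P , x-tight) i Si≡true = begin
      normal i · x                                      ≈⟨ *-identityˡ _ ⟨
      1# * (normal i · x)                               ≡⟨ ≡.cong (λ b → (if b then 1# else 0#) * (normal i · x)) Si≡true ⟨
      (if S i then 1# else 0#) * (normal i · x)         ≈⟨ sum-≈⇒≈ bound equal i ⟩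
      (if S i then 1# else 0#) * offset i               ≡⟨ ≡.cong (λ b → (if b then 1# else 0#) * offset i) Si≡true ⟩
      1# * offset i                                     ≈⟨ *-identityˡ _ ⟩
      offset i                                          ∎
      where
      bound : ∀ i → (if S i then 1# else 0#) * (normal i · x) ≤ (if S i then 1# else 0#) * offset i
      bound i with S i
      ... | true  = *-monoˡ-≤ 0≤1 (x∈P i)
      ... | false = ≤.reflexive (trans (zeroˡ _) (sym (zeroˡ _)))
      equal : sum (λ i → (if S i then 1# else 0#) * (normal i · x)) ≈ sum (λ i → (if S i then 1# else 0#) * offset i)
      equal = trans (sym (trans (·-comm _ x) (trans (·-combination x (λ i → if S i then 1# else 0#) normal)
        (sum-cong-≋ (λ i → *-congˡ (·-comm x (normal i))))))) x-tight

    points-resp : ∀ {x y} → x ≋ y → x ∈ points P → y ∈ points P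
    points-resp x≋y x∈P i = ≤-respˡ (·-congʳ (normal i) x≋y) (x∈P i)

    facePoints-resp : ∀ (F : Face P) {x y} → x ≋ y → x ∈ facePoints F → y ∈ facePoints F
    facePoints-resp F x≋y (x∈P , x-tight) =
      points-resp x≋y x∈P , trans (·-congʳ (Face.direction F) (λ i → sym (x≋y i))) x-tight

    midpoint∈ : ∀ {x y} → x ∈ points P → y ∈ points P → midpoint x y ∈ points P
    midpoint∈ x∈P y∈P i = midpoint-≤ (normal i) (x∈P i) (y∈P i)

    -- A short step exhausts no positive slack, and the inequalities without slack do not grow along
    -- `d`.
    move : ∀ p d → p ∈ points P → (∀ i → Tight i p → normal i · d ≤ 0#) →
      HoldsForSmall (λ ε → p +ᵥ ε *ᵥ d ∈ points P)
    move p d p∈P inward =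
      let ε , 0<ε , small = holdsForSmall-all (λ i → scaled-≤ (x≤y⇒0≤y-x (p∈P i)) (λ s≈0 → inward i (sym (-≈0⇒≈ s≈0))))
      in ε , 0<ε , λ δ 0<δ δ≤ε i → ≤-resp
           (begin
             δ * (normal i · d) + normal i · p    ≈⟨ +-comm _ _ ⟩
             normal i · p + δ * (normal i · d)    ≈⟨ +-congˡ (·-* δ (normal i) d) ⟨
             normal i · p + normal i · (δ *ᵥ d)   ≈⟨ ·-+ (normal i) p (δ *ᵥ d) ⟨
             normal i · (p +ᵥ δ *ᵥ d)             ∎)
           (solve 2 (λ o x → (o :- x) :+ x := o) refl (offset i) (normal i · p))
           (+-monoˡ-≤ (normal i · p) (small δ 0<δ δ≤ε i))

    -- The segment from z to b can be prolonged beyond b inside P, and a linear functional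
    -- that is maximal at an interior point of a segment is constant on it.
    face-absorbs : ∀ (F : Face P) {b z} → b ∈ facePoints F → z ∈ points P →
      (∀ i → Tight i b → Tight i z) → z ∈ facePoints F
    face-absorbs F {b} {z} (b∈P , b-tight) z∈P tight =
      z∈P , ≤.antisym (valid z z∈P) (*-cancelˡ-≤ 0<ε (0≤y-x⇒x≤y (≤-respʳ
        (begin
          value - direction · (b +ᵥ ε *ᵥ (b -ᵥ z))                       ≈⟨ +-congˡ (-‿cong (trans (·-+ direction b _) (+-congˡ (trans (·-* ε direction _) (*-congˡ (·-- direction b z)))))) ⟩
          value - (direction · b + ε * (direction · b - direction · z))  ≈⟨ +-congˡ (-‿cong (+-cong b-tight (*-congˡ (+-congʳ b-tight)))) ⟩
          value - (value + ε * (value - direction · z))                  ≈⟨ solve 3 (λ v e x → v :- (v :+ e :* (v :- x)) := e :* x :- e :* v) refl value ε (direction · z) ⟩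
          ε * (direction · z) - ε * value                                ∎)
        (x≤y⇒0≤y-x (valid _ moved)))))
      where
      open Face F using (direction; value; valid)
      prolongation = move b (b -ᵥ z) b∈P (λ i b-tight → ≤.reflexive
        (trans (·-- (normal i) b z) (≈⇒-≈0 (trans b-tight (sym (tight i b-tight))))))
      ε = proj₁ prolongation
      0<ε = proj₁ (proj₂ prolongation)
      moved = proj₂ (proj₂ prolongation) ε 0<ε ≤.refl

    -- The witnesses are averaged in one at a time: a midpoint is tight only if both ends are, so
    -- strictness gained earlier survives. `X l` exempts an inequality, such as the one that defines
    -- a facet.
    relativeInterior : ∀ {ℓ} (F : Face P) p → p ∈ facePoints F → (f : Fin k → Fin size) {X : Fin k → Set ℓ} →
      (∀ l → X l ⊎ (∃[ x ] x ∈ facePoints F × Strict (f l) x)) →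
      ∃[ b ] b ∈ facePoints F × (∀ l → X l ⊎ Strict (f l) b)
    relativeInterior {k = zero}  F p p∈F f strict = p , p∈F , λ ()
    relativeInterior {k = suc k} F p p∈F f strict with relativeInterior F p p∈F (f ∘ suc) (strict ∘ suc) | strict zero
    ... | b , b∈F , b-strict | inj₁ x = b , b∈F , λ { zero → inj₁ x ; (suc l) → b-strict l }
    ... | b , (b∈P , b-tight) , b-strict | inj₂ (x , (x∈P , x-tight) , x-strict) =
      midpoint b x , (midpoint∈ b∈P x∈P , midpoint-≈ (Face.direction F) b-tight x-tight) , λ where
        zero    → inj₂ (≤∧≉⇒< (midpoint∈ b∈P x∈P (f zero)) (λ eq →
                    <⇒≉ x-strict (midpoint-≈ʳ (normal (f zero)) (b∈P _) (x∈P _) eq)))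
        (suc l) → [ inj₁ , (λ b<o → inj₂ (≤∧≉⇒< (midpoint∈ b∈P x∈P (f (suc l))) (λ eq →
                    <⇒≉ b<o (midpoint-≈ˡ (normal (f (suc l))) (b∈P _) (x∈P _) eq)))) ]′ (b-strict l)

    vertex∈ : ∀ {v} → IsVertex P v → v ∈ points P
    vertex∈ {v} (F , exposes) = proj₁ (Equivalence.from (exposes v) (λ _ → refl))

    -- The functional exposing `v` is at most `value` at `x` and at `y`, and its weighted values
    -- balance to exactly `value`; as the weight of `y` is positive, `y` attains it too.
    -- Unnormalised weights avoid a division.
    vertex-extreme : ∀ {v x y s t} → IsVertex P v → x ∈ points P → y ∈ points P →
      0# ≤ s → 0# < t → (s + t) *ᵥ v ≋ s *ᵥ x +ᵥ t *ᵥ y → y ≋ v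
    vertex-extreme {v} {x} {y} {s} {t} (F , exposes) x∈P y∈P 0≤s 0<t eq =
      Equivalence.to (exposes y) (y∈P , ≤.antisym (valid y y∈P) (*-cancelˡ-≤ 0<t (0≤y-x⇒x≤y (≤-respʳ
        (begin
          s * (value - direction · x)                                       ≈⟨ solve 5 (λ s t v x y → s :* (v :- x) := ((s :+ t) :* v :- (s :* x :+ t :* y)) :+ (t :* y :- t :* v)) refl s t value (direction · x) (direction · y) ⟩
          ((s + t) * value - (s * (direction · x) + t * (direction · y))) + (t * (direction · y) - t * value)
                                                                            ≈⟨ +-congʳ (≈⇒-≈0 balance) ⟩
          0# + (t * (direction · y) - t * value)                            ≈⟨ +-identityˡ _ ⟩
          t * (direction · y) - t * value                                   ∎)
        (*-nonNegative 0≤s (x≤y⇒0≤y-x (valid x x∈P)))))))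
      where
      open Face F using (direction; value; valid)
      balance : (s + t) * value ≈ s * (direction · x) + t * (direction · y)
      balance = begin
        (s + t) * value                              ≈⟨ *-congˡ (proj₂ (Equivalence.from (exposes v) (λ _ → refl))) ⟨
        (s + t) * (direction · v)                    ≈⟨ ·-* (s + t) direction v ⟨
        direction · ((s + t) *ᵥ v)                   ≈⟨ ·-congʳ direction eq ⟩
        direction · (s *ᵥ x +ᵥ t *ᵥ y)               ≈⟨ ·-+ direction _ _ ⟩
        direction · (s *ᵥ x) + direction · (t *ᵥ y)  ≈⟨ +-cong (·-* s direction x) (·-* t direction y) ⟩
        s * (direction · x) + t * (direction · y)    ∎

    module _ {S : Pred (Point n) ℓ} (S-line : HasDimension S 1) where

      private
        p₀ = proj₁ S-line zero
        p₁ = proj₁ S-line (suc zero)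

        Position : Point n → Carrier → Set _
        Position x s = ∀ i → x i ≈ p₀ i + s * (p₁ i - p₀ i)

        position : ∀ {x} → x ∈ S → ∃ (Position x)
        position {x} x∈S with proj₂ (proj₂ (proj₂ S-line)) x x∈S
        ... | a , Σa≈1 , eq = a (suc zero) , λ i → begin
          x i                                                            ≈⟨ eq i ⟨
          a zero * p₀ i + (a (suc zero) * p₁ i + 0#)                     ≈⟨ +-congˡ (+-identityʳ _) ⟩
          a zero * p₀ i + a (suc zero) * p₁ i                            ≈⟨ solve 4 (λ a b p q → a :* p :+ b :* q := (a :+ b) :* p :+ b :* (q :- p)) refl _ _ (p₀ i) (p₁ i) ⟩
          (a zero + a (suc zero)) * p₀ i + a (suc zero) * (p₁ i - p₀ i)  ≈⟨ +-congʳ (*-congʳ (trans (+-congˡ (sym (+-identityʳ _))) Σa≈1)) ⟩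
          1# * p₀ i + a (suc zero) * (p₁ i - p₀ i)                       ≈⟨ +-congʳ (*-identityˡ _) ⟩
          p₀ i + a (suc zero) * (p₁ i - p₀ i)                            ∎

        -- With parameters along the line, `y` is the combination of `z` and `x` with weights
        -- `s - r` and `t - s`, which `vertex-extreme` forbids. The second weight is positive since
        -- `y` and `z` differ.
        between : ∀ {x y z r s t} → Position x r → Position y s → Position z t → IsVertex P y →
          x ∈ points P → z ∈ points P → ¬ x ≋ y → ¬ y ≋ z → r ≤ s → s ≤ t → ⊥
        between {x} {y} {z} {r} {s} {t} x-at y-at z-at y-vertex x∈P z∈P x≉y y≉z r≤s s≤t =
          x≉y (vertex-extreme {s = s - r} {t = t - s} y-vertex z∈P x∈P (x≤y⇒0≤y-x r≤s)
            (x<y⇒0<y-x (≤∧≉⇒< s≤t (λ s≈t → y≉z (λ i → begin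
              y i                          ≈⟨ y-at i ⟩
              p₀ i + s * (p₁ i - p₀ i)     ≈⟨ +-congˡ (*-congʳ s≈t) ⟩
              p₀ i + t * (p₁ i - p₀ i)     ≈⟨ z-at i ⟨
              z i                          ∎))))
            (λ i → begin
              ((s - r) + (t - s)) * y i                                                        ≈⟨ *-congˡ (y-at i) ⟩
              ((s - r) + (t - s)) * (p₀ i + s * (p₁ i - p₀ i))                                 ≈⟨ solve 5 (λ r s t p d → ((s :- r) :+ (t :- s)) :* (p :+ s :* d) := (s :- r) :* (p :+ t :* d) :+ (t :- s) :* (p :+ r :* d)) refl r s t (p₀ i) (p₁ i - p₀ i) ⟩
              (s - r) * (p₀ i + t * (p₁ i - p₀ i)) + (t - s) * (p₀ i + r * (p₁ i - p₀ i))      ≈⟨ +-cong (*-congˡ (z-at i)) (*-congˡ (x-at i)) ⟨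
              (s - r) * z i + (t - s) * x i                                                    ∎))

      noThreeVertices : ∀ {x y z} → x ∈ S → y ∈ S → z ∈ S →
        IsVertex P x → IsVertex P y → IsVertex P z → ¬ x ≋ y → ¬ z ≋ x → ¬ z ≋ y → ⊥
      noThreeVertices {x} {y} {z} x∈S y∈S z∈S x-vertex y-vertex z-vertex x≉y z≉x z≉y
        with position x∈S | position y∈S | position z∈S
      ... | r , x-at | s , y-at | t , z-at with ≤.total r s | ≤.total s t | ≤.total r t
      ... | inj₁ r≤s | inj₁ s≤t | _        = between x-at y-at z-at y-vertex (vertex∈ x-vertex) (vertex∈ z-vertex) x≉y (flip z≉y) r≤s s≤t
        where flip : ∀ {x y : Point n} → ¬ x ≋ y → ¬ y ≋ x
              flip x≉y y≋x = x≉y (λ i → sym (y≋x i))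
      ... | inj₁ r≤s | inj₂ t≤s | inj₁ r≤t = between x-at z-at y-at z-vertex (vertex∈ x-vertex) (vertex∈ y-vertex) (λ eq → z≉x (λ i → sym (eq i))) z≉y r≤t t≤s
      ... | inj₁ r≤s | inj₂ t≤s | inj₂ t≤r = between z-at x-at y-at x-vertex (vertex∈ z-vertex) (vertex∈ y-vertex) z≉x x≉y t≤r r≤s
      ... | inj₂ s≤r | inj₁ s≤t | inj₁ r≤t = between y-at x-at z-at x-vertex (vertex∈ y-vertex) (vertex∈ z-vertex) (λ eq → x≉y (λ i → sym (eq i))) (λ eq → z≉x (λ i → sym (eq i))) s≤r r≤t
      ... | inj₂ s≤r | inj₁ s≤t | inj₂ t≤r = between y-at z-at x-at z-vertex (vertex∈ y-vertex) (vertex∈ x-vertex) (λ eq → z≉y (λ i → sym (eq i))) z≉x s≤t t≤r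
      ... | inj₂ s≤r | inj₂ t≤s | _        = between z-at y-at x-at y-vertex (vertex∈ z-vertex) (vertex∈ x-vertex) z≉y (λ eq → x≉y (λ i → sym (eq i))) t≤s s≤r

    -- Adjacency speaks of an arbitrary exposing functional; this translates it into the listed
    -- inequalities. Those tight at the midpoint are tight at both ends, hence at `z`, so the edge
    -- would contain a third vertex.
    adjacent⇒noThirdVertex : ∀ {x y z} → Adjacent P x y → IsVertex P z → ¬ z ≋ x → ¬ z ≋ y →
      ¬ (∀ i → Tight i x → Tight i y → Tight i z)
    adjacent⇒noThirdVertex {x} {y} {z} (x-vertex , y-vertex , x≉y , E , E-edge , x∈E , y∈E) z-vertex z≉x z≉y tight =
      noThreeVertices E-edge x∈E y∈E z∈E x-vertex y-vertex z-vertex x≉y z≉x z≉y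
      where
      x∈P = vertex∈ x-vertex
      y∈P = vertex∈ y-vertex
      m∈E : midpoint x y ∈ facePoints E
      m∈E = midpoint∈ x∈P y∈P , midpoint-≈ (Face.direction E) (proj₂ x∈E) (proj₂ y∈E)
      z∈E : z ∈ facePoints E
      z∈E = face-absorbs E m∈E (vertex∈ z-vertex) (λ i m-tight →
        tight i (midpoint-≈ˡ (normal i) (x∈P i) (y∈P i) m-tight) (midpoint-≈ʳ (normal i) (x∈P i) (y∈P i) m-tight))

  module _ (P : Polytope (suc n)) (i : Fin (Polytope.size P)) (normal₀≉0 : ¬ Polytope.normal P i zero ≈ 0#)
    (b : Point (suc n)) (b∈F : b ∈ facePoints (facetOf P i)) (strict : ∀ l → l ≡ i ⊎ Strict P l b) where
    open Polytope P using (normal; offset)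
    open HyperplaneDirections (normal i) normal₀≉0

    private
      inward : ∀ j l → Tight P l b → normal l · along j ≤ 0#
      inward j l tight with strict l
      ... | inj₁ ≡.refl   = ≤.reflexive (normal-· j)
      ... | inj₂ b-strict = contradiction tight (<⇒≉ b-strict)

      near : HoldsForSmall (λ ε → ∀ j → b +ᵥ ε *ᵥ along j ∈ points P)
      near = holdsForSmall-all (λ j → move P b (along j) (proj₁ b∈F) (inward j))

      on-hyperplane : ∀ ε j → normal i · (b +ᵥ ε *ᵥ along j) ≈ offset i
      on-hyperplane ε j = begin
        normal i · (b +ᵥ ε *ᵥ along j)                   ≈⟨ ·-+ (normal i) b (ε *ᵥ along j) ⟩
        normal i · b + normal i · (ε *ᵥ along j)         ≈⟨ +-cong (proj₂ b∈F) (trans (·-* ε (normal i) (along j)) (trans (*-congˡ (normal-· j)) (zeroʳ ε))) ⟩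
        offset i + 0#                                    ≈⟨ +-identityʳ (offset i) ⟩
        offset i                                         ∎

    -- Every other inequality has slack at `b`, so all directions within the hyperplane can be
    -- followed for one common short step.
    facetOf-dimension : HasDimension (facePoints (facetOf P i)) n
    facetOf-dimension = dimension-from-directions b along b∈F (on-facet (witness near)) along-independent
      (λ x x∈F → along-spans (x -ᵥ b)
        (trans (·-- (normal i) x b) (≈⇒-≈0 (trans (proj₂ x∈F) (sym (proj₂ b∈F))))))
      where
      on-facet : ∃[ ε ] 0# < ε × (∀ j → b +ᵥ ε *ᵥ along j ∈ points P) →
        ∃[ ε ] 0# < ε × (∀ j → b +ᵥ ε *ᵥ along j ∈ facePoints (facetOf P i))
      on-facet (ε , 0<ε , near-b) = ε , 0<ε , λ j → near-b j , on-hyperplane ε j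

-- The facets, vertices and length of a spindle depend on its vertex–facet
-- incidences only: two vertices are adjacent iff no third one lies on all their
-- common facets. The path joins the apices, and by level-gap the level grows by
-- at most one along an edge.
record SpindleIncidence (m N L : ℕ) : Set where
  field
    incident : Fin N → Fin m → Bool

  Common : Fin N → Fin N → Fin N → Set
  Common k l z = ∀ i → incident k i ≡ true → incident l i ≡ true → incident z i ≡ true

  field
    vertex-separated : ∀ {k l} → k ≢ l → ∃[ i ] incident k i ≡ true × incident l i ≡ false
    facet-inhabited  : ∀ i → ∃[ k ] incident k i ≡ true
    facet-separated  : ∀ {i j} → i ≢ j → ∃[ k ] incident k i ≡ true × incident k j ≡ false
    path             : Fin (suc L) → Fin N
    path-distinct    : ∀ i → path (inject₁ i) ≢ path (suc i)
    path-edge        : ∀ i z → Common (path (inject₁ i)) (path (suc i)) z →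
                       z ≡ path (inject₁ i) ⊎ z ≡ path (suc i)
    level            : Fin N → ℕ
    level-first      : level (path zero) ≡ 0
    level-last       : level (path (fromℕ L)) ≡ L
    level-gap        : ∀ {k l} → suc (level k) ℕ.< level l →
                       ∃[ z ] z ≢ k × z ≢ l × Common k l z
    apices           : ∀ i → (incident (path zero) i ≡ true × incident (path (fromℕ L)) i ≡ false) ⊎
                             (incident (path zero) i ≡ false × incident (path (fromℕ L)) i ≡ true)

-- From incidences and maxima to facets, vertices and length.

module SpindleConstruction (K : OrderedField c ℓ₁ ℓ₂) {n N L : ℕ}
  (P : Polyhedral.Polytope K (suc n)) (I : SpindleIncidence (Polyhedral.Polytope.size P) N L) where

  open import Relation.Unary using (_∈_; _∉_)
  open OrderedField K hiding (zero)
  open OrderedFieldProperties K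
  open Polyhedral K
  open LinearAlgebra K
  open Faces K
  open SpindleIncidence I
  open Polytope P using (size; normal; offset)
  open Solver using (solve; _:+_; _:*_; _:-_; :-_; _:=_)
  open import Relation.Binary.Reasoning.Setoid (OrderedField.setoid K) hiding (stop)

  -- `maximal` says that the listed points determine the support function of `P`. It replaces the
  -- description of `P` as their convex hull throughout.
  module FromVertices
    (0<offset : ∀ i → 0# < offset i)
    (normal₀≉0 : ∀ i → ¬ normal i zero ≈ 0#)
    (w : Vector (Point (suc n)) N)
    (on-facet  : ∀ k i → incident k i ≡ true → Tight P i (w k))
    (off-facet : ∀ k i → incident k i ≡ false → Strict P i (w k))
    (maximal : ∀ d → ∃[ k ] (∀ x → x ∈ points P → d · x ≤ d · w k))
    where

    w∈P : ∀ k → w k ∈ points P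
    w∈P k i with incident k i in eq
    ... | true  = ≤.reflexive (on-facet k i eq)
    ... | false = <⇒≤ (off-facet k i eq)

    tight⇒incident : ∀ {k i} → Tight P i (w k) → incident k i ≡ true
    tight⇒incident {k} {i} tight with incident k i in eq
    ... | true  = ≡.refl
    ... | false = contradiction tight (<⇒≉ (off-facet k i eq))

    w-injective : ∀ {k l} → w k ≋ w l → k ≡ l
    w-injective {k} {l} wk≋wl = decidable-stable (k Finₚ.≟ l) λ k≢l →
      let i , on , off = vertex-separated k≢l in
      <⇒≉ (off-facet l i off) (trans (·-congʳ (normal i) (λ j → sym (wk≋wl j))) (on-facet k i on))

    -- Perturb the functional that exposes F slightly in the direction d: its maximum over
    -- the listed points is still attained on F.
    face-bound : ∀ (F : Face P) d {b} → (∀ k → w k ∈ facePoints F → d · w k ≤ b) →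
      ∀ x → x ∈ facePoints F → d · x ≤ b
    face-bound F d {b} w≤b x (x∈P , x-tight) = *-cancelˡ-≤ 0<ε (0≤y-x⇒x≤y (≤-respʳ
        (begin
          (value + ε * b) - (value + ε * (d · x))    ≈⟨ solve 3 (λ v s t → (v :+ s) :- (v :+ t) := s :- t) refl value _ _ ⟩
          ε * b - ε * (d · x)                        ∎)
        (x≤y⇒0≤y-x (≤-respˡ (trans (value-at x) (+-congʳ x-tight)) (≤.trans (max x x∈P) (≤-respˡ (sym (value-at (w k))) (at-w k)))))))
      where
      open Face F using (direction; value; valid)
      small = holdsForSmall-all (λ k → scaled-≤ {a = d · w k - b} {s = value - direction · w k}
        (x≤y⇒0≤y-x (valid (w k) (w∈P k)))
        (λ s≈0 → ≤-respʳ (-‿inverseʳ b) (+-monoˡ-≤ (- b) (w≤b k (w∈P k , sym (-≈0⇒≈ s≈0))))))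
      ε = proj₁ small
      0<ε = proj₁ (proj₂ small)
      perturbed : Point (suc n)
      perturbed = direction +ᵥ ε *ᵥ d
      value-at : ∀ y → perturbed · y ≈ direction · y + ε * (d · y)
      value-at y = trans (+-· direction (ε *ᵥ d) y) (+-congˡ (*-· ε d y))
      k = proj₁ (maximal perturbed)
      max = proj₂ (maximal perturbed)
      at-w : ∀ k → direction · w k + ε * (d · w k) ≤ value + ε * b
      at-w k = 0≤y-x⇒x≤y (≤-respʳ
        (solve 5 (λ v x e d b → (v :- x) :- e :* (d :- b) := (v :+ e :* b) :- (x :+ e :* d)) refl value (direction · w k) ε (d · w k) b)
        (x≤y⇒0≤y-x (proj₂ (proj₂ small) ε 0<ε ≤.refl k)))

    face-constant : ∀ (F : Face P) d {b} → (∀ k → w k ∈ facePoints F → d · w k ≈ b) →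
      ∀ x → x ∈ facePoints F → d · x ≈ b
    face-constant F d {b} w≈b x x∈F = ≤.antisym
      (face-bound F d (λ k wk∈F → ≤.reflexive (w≈b k wk∈F)) x x∈F)
      (≤-resp (-‿involutive b) (-‿involutive (d · x)) (neg-≤ (≤-respˡ (neg x)
        (face-bound F (0ᵥ -ᵥ d) (λ k wk∈F → ≤.reflexive (trans (neg (w k)) (-‿cong (w≈b k wk∈F)))) x x∈F))))
      where
      neg : ∀ y → (0ᵥ -ᵥ d) · y ≈ - (d · y)
      neg y = trans (-‿· 0ᵥ d y) (trans (+-congʳ (trans (·-comm 0ᵥ y) (·-zero y))) (+-identityˡ _))

    -- The cut by all facets through `w k` contains no other listed point. Hence the coordinate
    -- functionals are constant on it, which pins down every coordinate.
    w-vertex : ∀ k → IsVertex P (w k)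
    w-vertex k = F , λ x → mk⇔ (unique x) (λ x≋wk → facePoints-resp P F (λ j → sym (x≋wk j)) wk∈F)
      where
      F = cut P (incident k)
      wk∈F : w k ∈ facePoints F
      wk∈F = ∈-cut⁺ P (incident k) {w k} (w∈P k) (on-facet k)
      only : ∀ l → w l ∈ facePoints F → l ≡ k
      only l wl∈F = ≡.sym (decidable-stable (k Finₚ.≟ l) λ k≢l →
        let i , on , off = vertex-separated k≢l in
        <⇒≉ (off-facet l i off) (∈-cut⁻ P (incident k) {w l} wl∈F i on))
      unique : ∀ x → x ∈ facePoints F → x ≋ w k
      unique x x∈F j = trans (sym (unit-· j x)) (trans
        (face-constant F (unit j) (λ l wl∈F → reflexive (≡.cong (λ l → unit j · w l) (only l wl∈F))) x x∈F)
        (unit-· j (w k)))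

    -- The listed maximiser of the functional that exposes `v` lies in the exposed face, whose only
    -- point is `v`.
    vertex-listed : ∀ {v} → IsVertex P v → ∃[ k ] w k ≋ v
    vertex-listed {v} v-vertex@(F , exposes) = k , Equivalence.to (exposes (w k))
      (w∈P k , ≤.antisym (valid (w k) (w∈P k)) (≤-respˡ (proj₂ v∈F) (max v (proj₁ v∈F))))
      where
      open Face F using (direction; valid)
      v∈F = Equivalence.from (exposes v) (λ _ → refl)
      k = proj₁ (maximal direction)
      max = proj₂ (maximal direction)

    -- The cut by the common facets has only `w k` and `w l` as listed points, so a functional that
    -- agrees on these two is constant on the cut; by `segment-dimension` it is a segment.
    common-edge : ∀ {k l} → k ≢ l → (∀ z → Common k l z → z ≡ k ⊎ z ≡ l) → Adjacent P (w k) (w l)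
    common-edge {k} {l} k≢l only =
      w-vertex k , w-vertex l , (λ wk≋wl → k≢l (w-injective wk≋wl)) , E , E-edge , wk∈E , wl∈E
      where
      S : Fin size → Bool
      S i = incident k i ∧ incident l i
      E : Face P
      E = cut P S
      wk∈E : w k ∈ facePoints E
      wk∈E = ∈-cut⁺ P S {w k} (w∈P k) (λ i Si → on-facet k i (Boolₚ.∧-conicalˡ _ _ Si))
      wl∈E : w l ∈ facePoints E
      wl∈E = ∈-cut⁺ P S {w l} (w∈P l) (λ i Si → on-facet l i (Boolₚ.∧-conicalʳ (incident k i) _ Si))

      constant : ∀ d → d · w l ≈ d · w k → ∀ x → x ∈ facePoints E → d · x ≈ d · w k
      constant d eq = face-constant E d at-w
        where
        at-w : ∀ z → w z ∈ facePoints E → d · w z ≈ d · w k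
        at-w z wz∈E with only z (λ i on-k on-l → tight⇒incident (∈-cut⁻ P S {w z} wz∈E i (≡.cong₂ _∧_ on-k on-l)))
        ... | inj₁ ≡.refl = refl
        ... | inj₂ ≡.refl = eq

      E-edge : IsEdge P E
      E-edge = segment-dimension wk∈E (facePoints-resp P E) wl∈E (λ wl≋wk → k≢l (w-injective (λ j → sym (wl≋wk j)))) constant

    0∈P : 0ᵥ ∈ points P
    0∈P i = <⇒≤ (<-resp (sym (·-zero (normal i))) refl (0<offset i))

    0-strict : ∀ i → Strict P i 0ᵥ
    0-strict i = <-resp (sym (·-zero (normal i))) refl (0<offset i)

    P-dimension : HasDimension (points P) (suc n)
    P-dimension = dimension-from-directions 0ᵥ unit 0∈P (witness near)
      (λ a a≈0 j → trans (sym (combination-unit a j)) (a≈0 j))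
      (λ x _ → x -ᵥ 0ᵥ , combination-unit (x -ᵥ 0ᵥ))
      where
      near : HoldsForSmall (λ ε → ∀ j → 0ᵥ +ᵥ ε *ᵥ unit j ∈ points P)
      near = holdsForSmall-all (λ j → move P 0ᵥ (unit j) 0∈P (λ i tight → contradiction tight (<⇒≉ (0-strict i))))

    -- For each other inequality `facet-separated` provides a vertex of the facet that is strict for
    -- it; their successive midpoints end in `b`.
    facet-interior : ∀ i → ∃[ b ] b ∈ facePoints (facetOf P i) × (∀ l → l ≡ i ⊎ Strict P l b)
    facet-interior i = let k , on = facet-inhabited i in
      relativeInterior P (facetOf P i) (w k) (w∈P k , on-facet k i on) id strict
      where
      strict : ∀ l → l ≡ i ⊎ ∃[ x ] x ∈ facePoints (facetOf P i) × Strict P l x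
      strict l with l Finₚ.≟ i
      ... | yes l≡i = inj₁ l≡i
      ... | no  l≢i = let k , on , off = facet-separated (λ i≡l → l≢i (≡.sym i≡l)) in
        inj₂ (w k , (w∈P k , on-facet k i on) , off-facet k l off)

    facet-dimension : ∀ i → HasDimension (facePoints (facetOf P i)) n
    facet-dimension i with facet-interior i
    ... | b , b∈F , strict = facetOf-dimension P i (normal₀≉0 i) b b∈F strict

    facet-isFacet : ∀ i → IsFacet P (facetOf P i)
    facet-isFacet i = n , P-dimension , facet-dimension i

    SameFace : Face P → Face P → Set _
    SameFace F G = ∀ x → x ∈ facePoints F ⇔ x ∈ facePoints G

    somewhereStrict : ∀ (F : Face P) {k} (p : Vector (Point (suc n)) k) → (∀ j → p j ∈ facePoints F) → ∀ l →
      ¬ (∀ j → Tight P l (p j)) → ∃[ x ] x ∈ facePoints F × Strict P l x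
    somewhereStrict F p p∈F l not-tight
      with Finₚ.¬∀⟶∃¬ _ (λ j → Tight P l (p j)) (λ j → tight? P l (p j)) not-tight
    ... | j , ¬tight = p j , p∈F j , ≤∧≉⇒< (proj₁ (p∈F j) l) ¬tight

    -- Otherwise averaging points of the frame would give a point of `F` that is strict for every
    -- inequality. That point would absorb all of `P` into `F`, against the dimensions.
    supporting : ∀ (F : Face P) {k} → HasDimension (points P) (suc k) → (F-dim : HasDimension (facePoints F) k) →
      ∃[ i ] (∀ j → Tight P i (proj₁ F-dim j))
    supporting F P-dim F-dim@(p , p∈F , _) with Finₚ.any? (λ i → Finₚ.all? (λ j → tight? P i (p j)))
    ... | yes found = found
    ... | no  none with relativeInterior P F (p zero) (p∈F zero) id {X = λ _ → ⊥}
                          (λ l → inj₂ (somewhereStrict F p p∈F l (λ tight → none (l , tight))))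
    ...   | b , b∈F , strict = contradiction (dimension-mono P⊆F P-dim F-dim) (ℕₚ.<⇒≱ ℕₚ.≤-refl)
      where
      P⊆F : ∀ x → x ∈ points P → x ∈ facePoints F
      P⊆F x x∈P = face-absorbs P F {b} {x} b∈F x∈P (λ l tight → contradiction tight (<⇒≉ ([ (λ ()) , id ]′ (strict l))))

    -- The frame of `F` has as many points as the ambient dimension, and they lie on one listed
    -- hyperplane. As its offset is positive, it misses the origin and is spanned by the frame. Both
    -- faces are therefore the part of `P` in the same affine hull.
    facet-listed : ∀ F → IsFacet P F → ∃[ i ] SameFace (facetOf P i) F
    facet-listed F (k , P-dim , F-dim) = listed (dimension-unique P-dim P-dimension) F-dim (supporting F P-dim F-dim)
      where
      listed : suc k ≡ suc n → (F-dim : HasDimension (facePoints F) k) →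
        ∃[ i ] (∀ j → Tight P i (proj₁ F-dim j)) → ∃[ i ] SameFace (facetOf P i) F
      listed ≡.refl (p , p∈F , independent , hull) (i , tight) = i , λ x → mk⇔
        (λ (x∈P , x-tight) → x∈P , hull-value (Face.direction F) p x (λ j → proj₂ (p∈F j))
          (hyperplane-hull (normal i) (pos⇒≉0 (0<offset i)) p independent tight x x-tight))
        (λ x∈F → proj₁ x∈F , hull-value (normal i) p x tight (hull x x∈F))

    private
      u v : Fin N
      u = path zero
      v = path (fromℕ L)

      on-facet-face : ∀ k i → incident k i ≡ true → w k ∈ facePoints (facetOf P i)
      on-facet-face k i on = w∈P k , on-facet k i on

      off-facet-face : ∀ k i → incident k i ≡ false → w k ∉ facePoints (facetOf P i)
      off-facet-face k i off (_ , tight) = <⇒≉ (off-facet k i off) tight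

      u≢v : 0 ℕ.< size → u ≢ v
      u≢v (s≤s _) u≡v with apices zero
      ... | inj₁ (on , off) = contradiction (≡.trans (≡.sym on) (≡.trans (≡.cong (λ k → incident k zero) u≡v) off)) λ ()
      ... | inj₂ (off , on) = contradiction (≡.trans (≡.sym off) (≡.trans (≡.cong (λ k → incident k zero) u≡v) on)) λ ()

    spindle : 0 ℕ.< size → Spindle (suc n) (suc n)
    spindle 0<size = record
      { polytope = P ; hasDimension = P-dimension ; u = w u ; v = w v
      ; u-vertex = w-vertex u ; v-vertex = w-vertex v ; u≉v = λ eq → u≢v 0<size (w-injective eq)
      ; exactlyOne = λ F F-facet → exactlyOne F (facet-listed F F-facet) }
      where
      exactlyOne : ∀ F → ∃[ i ] SameFace (facetOf P i) F →
        (w u ∈ facePoints F × w v ∉ facePoints F) ⊎ (w u ∉ facePoints F × w v ∈ facePoints F)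
      exactlyOne F (i , same) with apices i
      ... | inj₁ (on , off) = inj₁ (Equivalence.to (same (w u)) (on-facet-face u i on) , λ v∈F → off-facet-face v i off (Equivalence.from (same (w v)) v∈F))
      ... | inj₂ (off , on) = inj₂ ((λ u∈F → off-facet-face u i off (Equivalence.from (same (w u)) u∈F)) , Equivalence.to (same (w v)) (on-facet-face v i on))

    facetCount : ∀ 0<size → FacetCount (spindle 0<size) size
    facetCount _ = record
      { to = λ i → facetOf P i , facet-isFacet i
      ; cong = λ { ≡.refl x → mk⇔ id id }
      ; bijective = (λ {i} {j} same → decidable-stable (i Finₚ.≟ j) λ i≢j →
            let k , on , off = facet-separated i≢j in
            off-facet-face k j off (Equivalence.to (same (w k)) (on-facet-face k i on)))
        , λ (F , F-facet) → let i , same = facet-listed F F-facet in i , λ { ≡.refl → same } }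

    vertexCount : ∀ 0<size → VertexCount (spindle 0<size) N
    vertexCount _ = record
      { to = λ k → w k , w-vertex k
      ; cong = λ { ≡.refl j → refl }
      ; bijective = w-injective
        , λ (x , x-vertex) → let k , wk≋x = vertex-listed x-vertex in k , λ { ≡.refl → wk≋x } }

    walk : ∀ {l} (p : Fin (suc l) → Fin N) → (∀ i → Adjacent P (w (p (inject₁ i))) (w (p (suc i)))) →
      Walk P l (w (p zero)) (w (p (fromℕ l)))
    walk {zero}  p adjacent = stop (λ _ → refl)
    walk {suc l} p adjacent = step (adjacent zero) (walk (p ∘ suc) (adjacent ∘ suc))

    -- The points of a walk agree with listed ones only up to `_≋_`, so the bound is stated for all
    -- their representatives.
    level-step : ∀ {x y k l} → w k ≋ x → w l ≋ y → Adjacent P x y → level l ℕ.≤ suc (level k)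
    level-step {x} {y} {k} {l} wk≋x wl≋y adjacent = ℕₚ.≮⇒≥ λ gap →
      let z , z≢k , z≢l , common = level-gap gap in
      adjacent⇒noThirdVertex P adjacent (w-vertex z)
        (λ wz≋x → z≢k (w-injective (λ j → trans (wz≋x j) (sym (wk≋x j)))))
        (λ wz≋y → z≢l (w-injective (λ j → trans (wz≋y j) (sym (wl≋y j)))))
        (λ i x-tight y-tight → on-facet z i (common i
          (tight⇒incident (trans (·-congʳ (normal i) wk≋x) x-tight))
          (tight⇒incident (trans (·-congʳ (normal i) wl≋y) y-tight))))

    -- The level acts as a potential: a walk is at least as long as the rise between its ends.
    -- `vertex-listed` supplies the level of each intermediate vertex.
    level-walk : ∀ {l x y k k′} → w k ≋ x → w k′ ≋ y → Walk P l x y → level k′ ℕ.≤ l ℕ.+ level k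
    level-walk wk≋x wk′≋y (stop x≋y) = ℕₚ.≤-reflexive (≡.cong level
      (w-injective (λ j → trans (wk′≋y j) (trans (sym (x≋y j)) (sym (wk≋x j))))))
    level-walk {suc l} {k = k} wk≋x wk′≋y (step adjacent rest) =
      let k″ , wk″≋ = vertex-listed (proj₁ (proj₂ adjacent)) in
      ℕₚ.≤-trans (level-walk wk″≋ wk′≋y rest)
        (ℕₚ.≤-trans (ℕₚ.+-monoʳ-≤ l (level-step wk≋x wk″≋ adjacent)) (ℕₚ.≤-reflexive (ℕₚ.+-suc l (level k))))

    spindle-length : ∀ 0<size → Length (spindle 0<size) L
    spindle-length _ =
      walk path (λ i → common-edge (path-distinct i) (path-edge i)) ,
      λ l uv-walk → ≡.subst₂ ℕ._≤_ level-last
        (≡.trans (≡.cong (l ℕ.+_) level-first) (ℕₚ.+-identityʳ l))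
        (level-walk (λ _ → refl) (λ _ → refl) uv-walk)

-- Integer certificates: sign changes, cones and their edge directions.

dot : Vec ℤ n → Vec ℤ n → ℤ
dot []      []      = 0ℤ
dot (x ∷ v) (y ∷ w) = x ℤ.* y ℤ.+ dot v w

-- Changes the signs of the chosen coordinates; the coordinate along the axis of
-- the spindle comes first and is always kept.
reflect : Vec Bool n → Vec ℤ (suc n) → Vec ℤ (suc n)
reflect s (x ∷ v) = x ∷ zipWith (λ b y → if b then ℤ.- y else y) s v

downward : Fin n → Vec ℤ (suc n)
downward i = 0ℤ ∷ tabulate (λ j → if does (i Finₚ.≟ j) then -1ℤ else 0ℤ)

-- A cell of a simplicial fan that refines the normal fan at a vertex of the
-- spindle. It is spanned by the sums of the pairs of normals in functional: a
-- normal paired with itself, or two normals whose sum lies on the axis. The corners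
-- are the vertices of a simple polyhedron with this normal fan; the edge of it that
-- leaves the i-th functional leads to another corner (inj₁) or is unbounded in a
-- negative coordinate direction (inj₂).
record Cone (n M : ℕ) : Set where
  field
    functional : Fin (suc n) → Vec ℤ (suc n) × Vec ℤ (suc n)
    ray        : Fin (suc n) → Fin (suc M) ⊎ Fin n
    corner     : Vec ℤ (suc n)
    vertex     : Vec ℤ (suc n)

module _ (cones : Fin (suc M) → Cone n M) (β : Fin (suc M)) where
  open Cone (cones β)

  rayVector : Fin (suc n) → Vec ℤ (suc n)
  rayVector j with ray j
  ... | inj₁ γ = zipWith ℤ._-_ (Cone.corner (cones γ)) corner
  ... | inj₂ i = downward i

  -- Pairing of generators with edge directions. A diagonal matrix with negative diagonal means that
  -- the rays are, up to negative factors, the dual basis of the generators.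
  slope : Fin (suc n) → Fin (suc n) → ℤ
  slope i j = dot (proj₁ (functional i)) (rayVector j) ℤ.+ dot (proj₂ (functional i)) (rayVector j)

-- All conditions compare integers or finite data, so a concrete instance can be settled by
-- evaluation. The sign vectors in the last two fields carry the cones from one orthant to all
-- others.
record IntegerSpindle (n m N L M : ℕ) : Set where
  field
    incidence : SpindleIncidence m N L
  open SpindleIncidence incidence public
  field
    radius      : ℤ
    0<radius    : 0ℤ ℤ.< radius
    normal      : Fin m → Vec ℤ (suc n)
    normal₀≢0   : ∀ i → lookup (normal i) zero ≢ 0ℤ
    vertex      : Fin N → Vec ℤ (suc n)
    on-facet    : ∀ k i → incident k i ≡ true → dot (normal i) (vertex k) ≡ radius
    off-facet   : ∀ k i → incident k i ≡ false → dot (normal i) (vertex k) ℤ.< radius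
    bound       : ℤ
    bounded     : ∀ k j → ℤ.- bound ℤ.≤ lookup (vertex k) j × lookup (vertex k) j ℤ.≤ bound
    cones       : Fin (suc M) → Cone n M
    slope-diagonal     : ∀ β j → slope cones β j j ℤ.< 0ℤ
    slope-off-diagonal : ∀ β {i j} → i ≢ j → slope cones β i j ≡ 0ℤ
    functional-at-vertex : ∀ β i → let open Cone (cones β) in
      dot (proj₁ (functional i)) (Cone.vertex (cones β)) ≡ radius ×
      dot (proj₂ (functional i)) (Cone.vertex (cones β)) ≡ radius
    functional-listed : ∀ s β i → let open Cone (cones β) in
      (∃[ l ] normal l ≡ reflect s (proj₁ (functional i))) × (∃[ l ] normal l ≡ reflect s (proj₂ (functional i)))
    vertex-listed : ∀ s β → ∃[ k ] vertex k ≡ reflect s (Cone.vertex (cones β))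

-- Optimality certified by a simplicial cone.

module Ascent (K : OrderedField c ℓ₁ ℓ₂) where

  open OrderedField K hiding (zero)
  open OrderedFieldProperties K
  open Polyhedral K
  open LinearAlgebra K
  open import Relation.Binary.Reasoning.Setoid (OrderedField.setoid K)

  maximum : (f : Vector Carrier (suc n)) → ∃[ i ] (∀ j → f j ≤ f i)
  maximum {n = zero}  f = zero , λ { zero → ≤.refl }
  maximum {n = suc n} f with maximum (tail f)
  ... | i , max with ≤.total (f zero) (f (suc i))
  ...   | inj₁ f₀≤ = suc i , λ { zero → f₀≤ ; (suc j) → max j }
  ...   | inj₂ ≤f₀ = zero , λ { zero → ≤.refl ; (suc j) → ≤.trans (max j) ≤f₀ }

  sum-only : ∀ i {f : Vector Carrier n} → (∀ j → i ≢ j → f j ≈ 0#) → sum f ≈ f i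
  sum-only zero    f≈0 = trans (+-congˡ (sum-≈0 (λ j → f≈0 (suc j) λ ()))) (+-identityʳ _)
  sum-only (suc i) f≈0 = trans (+-cong (f≈0 zero λ ()) (sum-only i (λ j i≢j → f≈0 (suc j) (λ { ≡.refl → i≢j ≡.refl })))) (+-identityˡ _)

  sum-nonPositive : {f : Vector Carrier n} → (∀ i → f i ≤ 0#) → sum f ≤ 0#
  sum-nonPositive {n = zero}  f≤0 = ≤.refl
  sum-nonPositive {n = suc n} f≤0 = ≤-respʳ (+-identityˡ 0#) (+-mono-≤ (f≤0 zero) (sum-nonPositive (f≤0 ∘ suc)))

  module _ (f r : Vector (Point n) n) (diagonal : ∀ i → f i · r i < 0#) (off-diagonal : ∀ {i j} → i ≢ j → f i · r j ≈ 0#) where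

    private
      coefficient : ∀ a i → f i · combination a r ≈ (f i · r i) * a i
      coefficient a i = trans (·-combination (f i) a r) (trans
        (sum-only i (λ j i≢j → trans (*-congˡ (off-diagonal i≢j)) (zeroʳ (a j)))) (*-comm _ _))

    rays-independent : LinearlyIndependent r
    rays-independent a ar≈0 i = no-zero-divisors (trans (sym (coefficient a i))
      (trans (·-congʳ (f i) ar≈0) (·-zero (f i)))) (<⇒≉ (diagonal i))

    -- Expanding `z` in the rays, instead of `d` in the generators, suffices: pairing with `f i`
    -- isolates the `i`-th coefficient of `z` and shows it to be nonnegative, while `d` is
    -- nonpositive on every ray.
    cone-bound : ∀ d z → (∀ i → d · r i ≤ 0#) → (∀ i → f i · z ≤ 0#) → d · z ≤ 0#
    cone-bound d z d·r≤0 f·z≤0 = conclude (basis-spans r rays-independent z)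
      where
      conclude : Spans r z → d · z ≤ 0#
      conclude (a , ar≋z) = ≤-respˡ
        (begin
          sum (λ i → a i * (d · r i))      ≈⟨ ·-combination d a r ⟨
          d · combination a r              ≈⟨ ·-congʳ d ar≋z ⟩
          d · z                            ∎)
        (sum-nonPositive {f = λ i → a i * (d · r i)} (λ i → ≤-respʳ (zeroʳ (a i)) (*-monoˡ-≤ (0≤a i) (d·r≤0 i))))
        where
        fr·a≤0 : ∀ i → (f i · r i) * a i ≤ 0#
        fr·a≤0 i = ≤-respˡ (trans (·-congʳ (f i) {z} {combination a r} (λ j → sym (ar≋z j))) (coefficient a i)) (f·z≤0 i)
        0≤a : ∀ i → 0# ≤ a i
        0≤a i with ≤.total 0# (a i)
        ... | inj₁ 0≤ = 0≤
        ... | inj₂ a≤0 = ≤.reflexive (sym (no-zero-divisors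
          (≤.antisym (fr·a≤0 i) (*-nonPositive (<⇒≤ (diagonal i)) a≤0)) (<⇒≉ (diagonal i))))

  -- Choosing the best of finitely many corners replaces both a proof that the cones cover all
  -- functionals and a termination argument for a path of improving edges. The conclusion concerns
  -- `top`, the vertex before perturbation, since only the generators `f β` link the two.
  ascent : (corner top : Vector (Point n) (suc M)) (f r : Fin (suc M) → Vector (Point n) n) →
    (∀ β i → f β i · r β i < 0#) → (∀ β {i j} → i ≢ j → f β i · r β j ≈ 0#) →
    ∀ d → (∀ β j → (∃[ γ ] r β j ≋ corner γ -ᵥ corner β) ⊎ d · r β j ≤ 0#) →
    ∃[ β ] (∀ x → (∀ i → f β i · x ≤ f β i · top β) → d · x ≤ d · top β)
  ascent corner top f r diagonal off-diagonal d improve with maximum (λ β → d · corner β)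
  ... | β , max = β , λ x f≤ → 0≤y-x⇒x≤y (≤-respʳ (flip-· x) (x≤0⇒0≤-x
      (cone-bound (f β) (r β) (diagonal β) (off-diagonal β) d (x -ᵥ top β) descends
        (λ i → ≤-resp (sym (·-- (f β i) x (top β))) (-‿inverseʳ _) (+-monoˡ-≤ (- (f β i · top β)) (f≤ i))))))
    where
    open Solver using (solve; _:-_; :-_; _:=_)
    flip-· : ∀ x → - (d · (x -ᵥ top β)) ≈ d · top β - d · x
    flip-· x = trans (-‿cong (·-- d x (top β))) (solve 2 (λ a b → :- (a :- b) := b :- a) refl _ _)
    descends : ∀ j → d · r β j ≤ 0#
    descends j with improve β j
    ... | inj₂ ≤0 = ≤0
    ... | inj₁ (γ , r≋) = ≤-resp (sym (trans (·-congʳ d r≋) (·-- d (corner γ) (corner β)))) (-‿inverseʳ _)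
                            (+-monoˡ-≤ (- (d · corner β)) (max γ))

-- Transfer of an integer certificate to an arbitrary ordered field.

module Realisation (K : OrderedField c ℓ₁ ℓ₂) {n m N L M : ℕ} (S : IntegerSpindle n m N L M) where

  open OrderedField K hiding (zero)
  open OrderedFieldProperties K
  open Polyhedral K
  open LinearAlgebra K
  open Faces K using (unit; unit-·; Tight; Strict)
  open Ascent K
  open IntegerSpindle S
  open import Relation.Binary.Reasoning.Setoid (OrderedField.setoid K)

  private variable
    k : ℕ

  embed : Vec ℤ k → Point k
  embed v i = fromℤ (lookup v i)

  embed-· : (v w : Vec ℤ k) → embed v · embed w ≈ fromℤ (dot v w)
  embed-· []      []      = refl
  embed-· (x ∷ v) (y ∷ w) = sym (trans (fromℤ-+ (x ℤ.* y) (dot v w)) (+-cong (fromℤ-* x y) (sym (embed-· v w))))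

  embed-- : (v w : Vec ℤ k) → embed (zipWith ℤ._-_ v w) ≋ embed v -ᵥ embed w
  embed-- v w i = trans (reflexive (≡.cong fromℤ (Vecₚ.lookup-zipWith ℤ._-_ i v w)))
    (trans (fromℤ-+ (lookup v i) (ℤ.- lookup w i)) (+-congˡ (fromℤ-neg (lookup w i))))

  reflectᴷ : Vec Bool k → Point (suc k) → Point (suc k)
  reflectᴷ s x zero    = x zero
  reflectᴷ s x (suc j) = if lookup s j then - x (suc j) else x (suc j)

  -- Sign changes are self-adjoint, so maximising `d` amounts to maximising its reflection over
  -- reflected points.
  reflectᴷ-· : ∀ s (x y : Point (suc k)) → reflectᴷ s x · y ≈ x · reflectᴷ s y
  reflectᴷ-· s x y = +-congˡ (sum-cong-≋ move-sign)
    where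
    move-sign : ∀ j → reflectᴷ s x (suc j) * y (suc j) ≈ x (suc j) * reflectᴷ s y (suc j)
    move-sign j with lookup s j
    ... | true  = trans (sym (-‿distribˡ-* _ _)) (-‿distribʳ-* _ _)
    ... | false = refl

  reflectᴷ-involutive : ∀ s (x : Point (suc k)) → reflectᴷ s (reflectᴷ s x) ≋ x
  reflectᴷ-involutive s x zero    = refl
  reflectᴷ-involutive s x (suc j) with lookup s j
  ... | true  = -‿involutive _
  ... | false = refl

  embed-reflect : ∀ s (v : Vec ℤ (suc k)) → embed (reflect s v) ≋ reflectᴷ s (embed v)
  embed-reflect s (x ∷ v) zero    = refl
  embed-reflect s (x ∷ v) (suc j) = trans (reflexive (≡.cong fromℤ (Vecₚ.lookup-zipWith _ j s v))) (sign (lookup s j))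
    where
    sign : ∀ b → fromℤ (if b then ℤ.- lookup v j else lookup v j) ≈ (if b then - fromℤ (lookup v j) else fromℤ (lookup v j))
    sign true  = fromℤ-neg (lookup v j)
    sign false = refl

  -- A `Polytope` contains a proof of its boundedness, which itself comes from the maxima; these are
  -- therefore established for the bare inequalities.
  Feasible : Point (suc n) → Set _
  Feasible x = ∀ i → embed (normal i) · x ≤ fromℤ radius

  module _ (d : Point (suc n)) where

    private
      signs : Vec Bool n
      -- Flipping the coordinates that are at most 0 makes the functional nonnegative off the
      -- height, hence nonincreasing along the unbounded edges.
      signs = tabulate (λ j → does (d (suc j) ≤.≤? 0#))

      c′ : Point (suc n)
      c′ = reflectᴷ signs d

      c′-nonNegative : ∀ j → 0# ≤ c′ (suc j)
      c′-nonNegative j rewrite Vecₚ.lookup∘tabulate (λ j → does (d (suc j) ≤.≤? 0#)) j with d (suc j) ≤.≤? 0#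
      ... | yes d≤0 = x≤0⇒0≤-x d≤0
      ... | no  0<d = <⇒≤ 0<d

      f r : Fin (suc M) → Vector (Point (suc n)) (suc n)
      f β i = embed (proj₁ (Cone.functional (cones β) i)) +ᵥ embed (proj₂ (Cone.functional (cones β) i))
      r β j = embed (rayVector cones β j)

      f·r : ∀ β i j → f β i · r β j ≈ fromℤ (slope cones β i j)
      f·r β i j = trans (+-· (embed a) (embed b) (r β j)) (trans (+-cong (embed-· a _) (embed-· b _))
        (sym (fromℤ-+ (dot a (rayVector cones β j)) (dot b (rayVector cones β j)))))
        where
        a = proj₁ (Cone.functional (cones β) i)
        b = proj₂ (Cone.functional (cones β) i)

      descending : ∀ i → c′ · embed (downward i) ≤ 0#
      descending i = ≤-respʳ (+-identityˡ 0#) (+-mono-≤ (≤.reflexive (zeroʳ _))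
        (sum-nonPositive {f = λ j → c′ (suc j) * embed (downward i) (suc j)} (λ j →
          ≤-respʳ (zeroʳ _) (*-monoˡ-≤ (c′-nonNegative j) (entry j)))))
        where
        entry : ∀ j → embed (downward i) (suc j) ≤ 0#
        entry j rewrite Vecₚ.lookup∘tabulate (λ j → if does (i Finₚ.≟ j) then -1ℤ else 0ℤ) j with does (i Finₚ.≟ j)
        ... | true  = 0≤x⇒-x≤0 (fromℤ-nonNegative 1)
        ... | false = ≤.refl

      improve : ∀ β j → (∃[ γ ] r β j ≋ embed (Cone.corner (cones γ)) -ᵥ embed (Cone.corner (cones β))) ⊎ c′ · r β j ≤ 0#
      improve β j with Cone.ray (cones β) j
      ... | inj₁ γ = inj₁ (γ , embed-- (Cone.corner (cones γ)) (Cone.corner (cones β)))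
      ... | inj₂ i = inj₂ (descending i)

      optimum : ∃[ β ] (∀ y → (∀ i → f β i · y ≤ f β i · embed (Cone.vertex (cones β))) → c′ · y ≤ c′ · embed (Cone.vertex (cones β)))
      optimum = ascent (λ β → embed (Cone.corner (cones β))) (λ β → embed (Cone.vertex (cones β))) f r
        (λ β i → <-resp (sym (f·r β i i)) refl (fromℤ-mono-< (slope-diagonal β i)))
        (λ β {i} {j} i≢j → trans (f·r β i j) (reflexive (≡.cong fromℤ (slope-off-diagonal β i≢j))))
        c′ improve

      listed-≤ : ∀ a x → Feasible x → ∃[ l ] normal l ≡ reflect signs a → embed a · reflectᴷ signs x ≤ fromℤ radius
      listed-≤ a x feasible (l , eq) = ≤-respˡ (begin
        embed (normal l) · x                 ≡⟨ ≡.cong (λ v → embed v · x) eq ⟩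
        embed (reflect signs a) · x          ≈⟨ ·-congˡ x (embed-reflect signs a) ⟩
        reflectᴷ signs (embed a) · x         ≈⟨ reflectᴷ-· signs (embed a) x ⟩
        embed a · reflectᴷ signs x           ∎) (feasible l)

    maximal : ∃[ k ] (∀ x → Feasible x → d · x ≤ d · embed (vertex k))
    maximal = let β , max = optimum in conclude β max (vertex-listed signs β)
      where
      conclude : ∀ β → (let top = Cone.vertex (cones β)) →
        (∀ y → (∀ i → f β i · y ≤ f β i · embed top) → c′ · y ≤ c′ · embed top) →
        ∃[ k ] vertex k ≡ reflect signs top → ∃[ k ] (∀ x → Feasible x → d · x ≤ d · embed (vertex k))
      conclude β max (k , eq) = k , λ x feasible → ≤-resp
        (begin
          c′ · reflectᴷ signs x                       ≈⟨ reflectᴷ-· signs d (reflectᴷ signs x) ⟩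
          d · reflectᴷ signs (reflectᴷ signs x)       ≈⟨ ·-congʳ d (reflectᴷ-involutive signs x) ⟩
          d · x                                       ∎)
        (begin
          c′ · embed top                              ≈⟨ reflectᴷ-· signs d (embed top) ⟩
          d · reflectᴷ signs (embed top)              ≈⟨ ·-congʳ d (embed-reflect signs top) ⟨
          d · embed (reflect signs top)               ≡⟨ ≡.cong (λ v → d · embed v) eq ⟨
          d · embed (vertex k)                        ∎)
        (max (reflectᴷ signs x) (bound-at x feasible))
        where
        top = Cone.vertex (cones β)
        bound-at : ∀ x → Feasible x → ∀ i → f β i · reflectᴷ signs x ≤ f β i · embed top
        -- Both normals of a pair are at most `radius` on the reflected point and equal to it at
        -- `top`. Adding the two bounds also covers sums that are not facet normals.
        bound-at x feasible i = ≤-resp (sym (+-· (embed a) (embed b) (reflectᴷ signs x)))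
          (begin
            fromℤ radius + fromℤ radius                ≡⟨ ≡.cong₂ (λ y z → fromℤ y + fromℤ z) (proj₁ (functional-at-vertex β i)) (proj₂ (functional-at-vertex β i)) ⟨
            fromℤ (dot a top) + fromℤ (dot b top)      ≈⟨ +-cong (embed-· a top) (embed-· b top) ⟨
            embed a · embed top + embed b · embed top  ≈⟨ +-· (embed a) (embed b) (embed top) ⟨
            f β i · embed top                          ∎)
          (+-mono-≤ (listed-≤ a x feasible (proj₁ (functional-listed signs β i)))
                    (listed-≤ b x feasible (proj₂ (functional-listed signs β i))))
          where
          a = proj₁ (Cone.functional (cones β) i)
          b = proj₂ (Cone.functional (cones β) i)

  -- The functionals `unit j` and their negatives are maximal at listed vertices, whose coordinates
  -- are bounded by `bound`.
  polytope-bounded : ∃[ B ] (∀ x → Feasible x → ∀ j → - B ≤ x j × x j ≤ B)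
  polytope-bounded = fromℤ bound , λ x feasible j →
      ≤-respʳ (-‿involutive (x j)) (neg-≤ (≤-respˡ (neg-unit j x) (lower x feasible j (maximal (0ᵥ -ᵥ unit j)))))
    , ≤-respˡ (unit-· j x) (upper x feasible j (maximal (unit j)))
    where
    neg-unit : ∀ j x → (0ᵥ -ᵥ unit j) · x ≈ - x j
    neg-unit j x = trans (-‿· 0ᵥ (unit j) x) (trans (+-cong (trans (·-comm 0ᵥ x) (·-zero x)) (-‿cong (unit-· j x))) (+-identityˡ _))
    upper : ∀ x → Feasible x → ∀ j → ∃[ k ] (∀ x → Feasible x → unit j · x ≤ unit j · embed (vertex k)) → unit j · x ≤ fromℤ bound
    upper x feasible j (k , max) = ≤.trans (max x feasible)
      (≤-respˡ (sym (unit-· j (embed (vertex k)))) (fromℤ-mono-≤ (proj₂ (bounded k j))))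
    lower : ∀ x → Feasible x → ∀ j → ∃[ k ] (∀ x → Feasible x → (0ᵥ -ᵥ unit j) · x ≤ (0ᵥ -ᵥ unit j) · embed (vertex k)) → (0ᵥ -ᵥ unit j) · x ≤ fromℤ bound
    lower x feasible j (k , max) = ≤.trans (max x feasible)
      (≤-resp (sym (neg-unit j (embed (vertex k)))) (-‿involutive (fromℤ bound))
        (neg-≤ (≤-respˡ (fromℤ-neg bound) (fromℤ-mono-≤ (proj₁ (bounded k j))))))

  polytope : Polytope (suc n)
  polytope = record { normal = λ i → embed (normal i) ; offset = λ _ → fromℤ radius ; bounded = polytope-bounded }

  open SpindleConstruction K polytope incidence

  realise : 0 ℕ.< m → Σ ℕ λ k → Σ (Spindle k (suc n)) λ S → FacetCount S m × VertexCount S N × Length S L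
  realise 0<m = suc n , Result.spindle 0<m , Result.facetCount 0<m , Result.vertexCount 0<m , Result.spindle-length 0<m
    where
    on : ∀ k i → incident k i ≡ true → Tight polytope i (embed (vertex k))
    on k i eq = trans (embed-· (normal i) (vertex k)) (reflexive (≡.cong fromℤ (on-facet k i eq)))
    off : ∀ k i → incident k i ≡ false → Strict polytope i (embed (vertex k))
    off k i eq = <-resp (sym (embed-· (normal i) (vertex k))) refl (fromℤ-mono-< (off-facet k i eq))
    module Result = FromVertices (λ _ → fromℤ-mono-< 0<radius)
      (λ i eq → normal₀≢0 i (fromℤ-injective eq)) (λ k → embed (vertex k)) on off maximal

-- Decision procedures for the incidence table.

open import Data.List.Membership.Propositional using (_∈_; _∉_; find)
open import Data.List.Membership.Propositional.Properties using (∈-lookup; ∈-filter⁺; ∈-filter⁻)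

_≟ᵥ_ : (v w : Vec ℤ n) → Dec (v ≡ w)
_≟ᵥ_ = Vecₚ.≡-dec ℤₚ._≟_

Vec-all? : ∀ n {P : Vec Bool n → Set} → (∀ s → Dec (P s)) → Dec (∀ s → P s)
Vec-all? zero    P? = map′ (λ { p [] → p }) (λ p → p []) (P? [])
Vec-all? (suc n) P? = map′ (λ { (p , q) (true ∷ s) → p s ; (p , q) (false ∷ s) → q s }) (λ p → p ∘ (true ∷_) , p ∘ (false ∷_))
  (Vec-all? n (P? ∘ (true ∷_)) ×-dec Vec-all? n (P? ∘ (false ∷_)))

-- Deciding membership through the primitive equality of ℕ keeps the computations below fast.
_∈ᵇ_ : ℕ → List ℕ → Bool
n ∈ᵇ []       = false
n ∈ᵇ (x ∷ xs) = (n ℕ.≡ᵇ x) ∨ (n ∈ᵇ xs)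

_∈?_ : ∀ n (xs : List ℕ) → Dec (n ∈ xs)
does  (n ∈? xs) = n ∈ᵇ xs
proof (n ∈? xs) = reflects xs
  where
  reflects : ∀ xs → Reflects (n ∈ xs) (n ∈ᵇ xs)
  reflects []       = ofⁿ λ ()
  reflects (x ∷ xs) with n ℕ.≡ᵇ x in eq | n ∈ᵇ xs | reflects xs
  ... | true  | _ | _        = ofʸ (here (ℕₚ.≡ᵇ⇒≡ n x (≡.subst T (≡.sym eq) tt)))
  ... | false | _ | ofʸ n∈xs = ofʸ (there n∈xs)
  ... | false | _ | ofⁿ n∉xs = ofⁿ λ { (here n≡x) → ≡.subst T eq (ℕₚ.≡⇒≡ᵇ n x n≡x) ; (there n∈xs) → n∉xs n∈xs }

_∉?_ : ∀ n (xs : List ℕ) → Dec (n ∉ xs)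
n ∉? xs = ¬? (n ∈? xs)

module _ {A : Set} where

  All-at : {P : A → Set} {xs : List A} → All P xs → ∀ k → P (List.lookup xs k)
  All-at {xs = xs} ps k = All.lookup ps (∈-lookup k)

  Any-at : {P : A → Set} {xs : List A} → Any P xs → ∃[ k ] P (List.lookup xs k)
  Any-at p = Any.index p , lookup-index p

  AllPairs-at : {R : A → A → Set} {xs : List A} → (∀ {x y} → R x y → R y x) → AllPairs R xs →
    ∀ {k l} → k ≢ l → R (List.lookup xs k) (List.lookup xs l)
  AllPairs-at sym (r ∷ rs) {zero}  {zero}  k≢l = contradiction ≡.refl k≢l
  AllPairs-at sym (r ∷ rs) {zero}  {suc l} k≢l = All-at r l
  AllPairs-at sym (r ∷ rs) {suc k} {zero}  k≢l = sym (All-at r k)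
  AllPairs-at sym (r ∷ rs) {suc k} {suc l} k≢l = AllPairs-at sym rs (k≢l ∘ ≡.cong suc)

decide : {A : Set} (A? : Dec A) → does A? ≡ true → A
decide (yes a) _ = a

does-false : {A : Set} (A? : Dec A) → does A? ≡ false → ¬ A
does-false (no ¬a) _ = ¬a

-- Storing the tight indices turns incidence queries into searches in short lists; `AllIncidences`
-- checks these lists against the actual dot products.
record Entry : Set where
  field
    level  : ℕ
    point  : Vec ℤ 5
    tights : List ℕ
open Entry

module IncidenceTable (scale : ℤ) (normals : List (Vec ℤ 5)) (entries : List Entry) where

  entry : Fin (length entries) → Entry
  entry = List.lookup entries

  incident : Fin (length entries) → Fin (length normals) → Bool
  incident k i = does (toℕ i ∈? tights (entry k))

  common : Entry → Entry → List ℕ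
  common x y = filter (_∈? tights y) (tights x)

  OnFacet OffFacet : Entry → ℕ → Vec ℤ 5 → Set
  OnFacet  e i q = i ∈ tights e → dot q (point e) ≡ scale
  OffFacet e i q = i ∉ tights e → dot q (point e) ℤ.< scale

  Incidences : Entry → ℕ → List (Vec ℤ 5) → Set
  Incidences e i []       = ⊤
  Incidences e i (q ∷ qs) = (OnFacet e i q × OffFacet e i q) × Incidences e (suc i) qs

  Separated : Entry → Entry → Set
  Separated x y = Any (_∉ tights y) (tights x)

  -- A search through a list compares the points themselves; distinct points occupy distinct
  -- positions, which is what `level-gap` asks for.
  Third : List ℕ → Entry → Entry → Entry → Set
  Third is x y z = All (_∈ tights z) is × point z ≢ point x × point z ≢ point y

  Edge : Fin (length entries) → Fin (length entries) → List ℕ → Set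
  Edge k l is = ∀ z → All (_∈ tights (entry z)) is → z ≡ k ⊎ z ≡ l

  AllIncidences AllSeparated TightsBelow FacetsInhabited FacetsSeparated LevelGaps Bounded : Set
  AllIncidences   = All (λ e → Incidences e 0 normals) entries
  AllSeparated    = AllPairs (λ x y → Separated x y × Separated y x) entries
  TightsBelow     = All (λ e → All (ℕ._< length normals) (tights e)) entries
  FacetsInhabited = ∀ (i : Fin (length normals)) → Any (λ e → toℕ i ∈ tights e) entries
  FacetsSeparated = ∀ (i j : Fin (length normals)) → i ≡ j ⊎ Any (λ e → toℕ i ∈ tights e × toℕ j ∉ tights e) entries
  LevelGaps       = All (λ x → All (λ y → suc (level x) ℕ.< level y → Any (Third (common x y) x y) entries) entries) entries
  Bounded         = All (λ e → ∀ (j : Fin 5) → ℤ.- scale ℤ.≤ lookup (point e) j × lookup (point e) j ℤ.≤ scale) entries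

  PathEdges PathDistinct Apices : (Fin 7 → Fin (length entries)) → Set
  PathEdges p    = ∀ (i : Fin 6) → let k = p (inject₁ i); l = p (suc i) in Edge k l (common (entry k) (entry l))
  PathDistinct p = ∀ (i : Fin 6) → p (inject₁ i) ≢ p (suc i)
  Apices p       = ∀ i → (incident (p zero) i ≡ true × incident (p (fromℕ 6)) i ≡ false) ⊎
                         (incident (p zero) i ≡ false × incident (p (fromℕ 6)) i ≡ true)

  private
    incidences? : ∀ e i qs → Dec (Incidences e i qs)
    incidences? e i []       = yes tt
    incidences? e i (q ∷ qs) =
      (((i ∈? tights e) →-dec (dot q (point e) ℤₚ.≟ scale)) ×-dec
       ((i ∉? tights e) →-dec (dot q (point e) ℤₚ.<? scale))) ×-dec incidences? e (suc i) qs

    separated? : ∀ x y → Dec (Separated x y)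
    separated? x y = any? (_∉? tights y) (tights x)

    third? : ∀ is x y → Dec (Any (Third is x y) entries)
    third? is x y = any? (λ z → All.all? (_∈? tights z) is ×-dec ¬? (point z ≟ᵥ point x) ×-dec ¬? (point z ≟ᵥ point y)) entries

    edge? : ∀ k l is → Dec (Edge k l is)
    edge? k l is = Finₚ.all? λ z → All.all? (_∈? tights (entry z)) is →-dec ((z Finₚ.≟ k) ⊎-dec (z Finₚ.≟ l))

    onFirstOnly? : ∀ i j → Dec (Any (λ e → i ∈ tights e × j ∉ tights e) entries)
    onFirstOnly? i j = any? (λ e → (i ∈? tights e) ×-dec (j ∉? tights e)) entries

  allIncidences? : Dec AllIncidences
  allIncidences? = All.all? (λ e → incidences? e 0 normals) entries

  allSeparated? : Dec AllSeparated
  allSeparated? = allPairs? (λ x y → separated? x y ×-dec separated? y x) entries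

  tightsBelow? : Dec TightsBelow
  tightsBelow? = All.all? (λ e → All.all? (ℕₚ._<? length normals) (tights e)) entries

  facetsInhabited? : Dec FacetsInhabited
  facetsInhabited? = Finₚ.all? λ i → any? (λ e → toℕ i ∈? tights e) entries

  facetsSeparated? : Dec FacetsSeparated
  facetsSeparated? = Finₚ.all? λ i → Finₚ.all? λ j → (i Finₚ.≟ j) ⊎-dec onFirstOnly? (toℕ i) (toℕ j)

  levelGaps? : Dec LevelGaps
  levelGaps? = All.all? (λ x → All.all? (λ y → (suc (level x) ℕₚ.<? level y) →-dec third? (common x y) x y) entries) entries

  bounded? : Dec Bounded
  bounded? = All.all? (λ e → Finₚ.all? λ j →
    (ℤ.- scale ℤₚ.≤? lookup (point e) j) ×-dec (lookup (point e) j ℤₚ.≤? scale)) entries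

  pathEdges? : ∀ p → Dec (PathEdges p)
  pathEdges? p = Finₚ.all? λ i → edge? (p (inject₁ i)) (p (suc i)) (common (entry (p (inject₁ i))) (entry (p (suc i))))

  pathDistinct? : ∀ p → Dec (PathDistinct p)
  pathDistinct? p = Finₚ.all? λ i → ¬? (p (inject₁ i) Finₚ.≟ p (suc i))

  verified? : ∀ p → Dec (AllIncidences × AllSeparated × TightsBelow × FacetsInhabited × FacetsSeparated × LevelGaps ×
    Bounded × PathEdges p × PathDistinct p)
  verified? p = allIncidences? ×-dec allSeparated? ×-dec tightsBelow? ×-dec facetsInhabited? ×-dec
    facetsSeparated? ×-dec levelGaps? ×-dec bounded? ×-dec pathEdges? p ×-dec pathDistinct? p

  apices? : ∀ p → Dec (Apices p)
  apices? p = Finₚ.all? λ i →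
    ((incident (p zero) i Boolₚ.≟ true) ×-dec (incident (p (fromℕ 6)) i Boolₚ.≟ false)) ⊎-dec
    ((incident (p zero) i Boolₚ.≟ false) ×-dec (incident (p (fromℕ 6)) i Boolₚ.≟ true))

  ∈⇒incident : ∀ k i → toℕ i ∈ tights (entry k) → incident k i ≡ true
  ∈⇒incident k i = dec-true (toℕ i ∈? tights (entry k))

  ∉⇒incident : ∀ k i → toℕ i ∉ tights (entry k) → incident k i ≡ false
  ∉⇒incident k i = dec-false (toℕ i ∈? tights (entry k))

  incident⇒∈ : ∀ k i → incident k i ≡ true → toℕ i ∈ tights (entry k)
  incident⇒∈ k i = decide (toℕ i ∈? tights (entry k))

  incident⇒∉ : ∀ k i → incident k i ≡ false → toℕ i ∉ tights (entry k)
  incident⇒∉ k i = does-false (toℕ i ∈? tights (entry k))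

  module _ (allIncidences : AllIncidences) where

    private
      incidence-at : ∀ e i qs → Incidences e i qs → ∀ j →
        OnFacet e (i ℕ.+ toℕ j) (List.lookup qs j) × OffFacet e (i ℕ.+ toℕ j) (List.lookup qs j)
      incidence-at e i (q ∷ qs) (p , _)  zero    rewrite ℕₚ.+-identityʳ i = p
      incidence-at e i (q ∷ qs) (_ , ps) (suc j) rewrite ℕₚ.+-suc i (toℕ j) = incidence-at e (suc i) qs ps j

    on-facet : ∀ k i → incident k i ≡ true → dot (List.lookup normals i) (point (entry k)) ≡ scale
    on-facet k i eq = proj₁ (incidence-at (entry k) 0 normals (All-at allIncidences k) i) (incident⇒∈ k i eq)

    off-facet : ∀ k i → incident k i ≡ false → dot (List.lookup normals i) (point (entry k)) ℤ.< scale
    off-facet k i eq = proj₂ (incidence-at (entry k) 0 normals (All-at allIncidences k) i) (incident⇒∉ k i eq)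

  module _
    (tightsBelow : TightsBelow) (allSeparated : AllSeparated)
    (facetsInhabited : FacetsInhabited) (facetsSeparated : FacetsSeparated) (levelGaps : LevelGaps)
    (p : Fin 7 → Fin (length entries)) (pathEdges : PathEdges p) (pathDistinct : PathDistinct p) (apices : Apices p)
    (level-first : level (entry (p zero)) ≡ 0) (level-last : level (entry (p (fromℕ 6))) ≡ 6)
    where

    private
      index : ∀ k {i} → i ∈ tights (entry k) → ∃[ j ] toℕ j ≡ i
      index k i∈k = let i<m = All.lookup (All-at tightsBelow k) i∈k in fromℕ< i<m , Finₚ.toℕ-fromℕ< i<m

      vertex-separated : ∀ {k l} → k ≢ l → ∃[ i ] incident k i ≡ true × incident l i ≡ false
      vertex-separated {k} {l} k≢l with find (proj₁ (AllPairs-at Product.swap allSeparated k≢l))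
      ... | i , i∈k , i∉l with index k i∈k
      ...   | j , ≡.refl = j , ∈⇒incident k j i∈k , ∉⇒incident l j i∉l

      facet-separated : ∀ {i j} → i ≢ j → ∃[ k ] incident k i ≡ true × incident k j ≡ false
      facet-separated {i} {j} i≢j with facetsSeparated i j
      ... | inj₁ i≡j = contradiction i≡j i≢j
      ... | inj₂ s with Any-at s
      ...   | k , i∈k , j∉k = k , ∈⇒incident k i i∈k , ∉⇒incident k j j∉k

      path-edge : ∀ i z → (∀ j → incident (p (inject₁ i)) j ≡ true → incident (p (suc i)) j ≡ true → incident z j ≡ true) →
        z ≡ p (inject₁ i) ⊎ z ≡ p (suc i)
      path-edge i z common⊆z = pathEdges i z (All.tabulate tight)
        where
        tight : ∀ {n} → n ∈ common (entry (p (inject₁ i))) (entry (p (suc i))) → n ∈ tights (entry z)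
        tight n∈ with ∈-filter⁻ (_∈? tights (entry (p (suc i)))) {xs = tights (entry (p (inject₁ i)))} n∈
        ... | n∈k , n∈l with index (p (inject₁ i)) n∈k
        ...   | j , ≡.refl = incident⇒∈ z j (common⊆z j (∈⇒incident _ j n∈k) (∈⇒incident _ j n∈l))

      level-gap : ∀ {k l} → suc (level (entry k)) ℕ.< level (entry l) → ∃[ z ] z ≢ k × z ≢ l ×
        (∀ i → incident k i ≡ true → incident l i ≡ true → incident z i ≡ true)
      level-gap {k} {l} gap with Any-at (All-at (All-at levelGaps k) l gap)
      ... | z , common⊆z , z≢k , z≢l = z , (λ z≡k → z≢k (≡.cong (point ∘ entry) z≡k)) , (λ z≡l → z≢l (≡.cong (point ∘ entry) z≡l)) ,
        λ i i∈k i∈l → ∈⇒incident z i (All.lookup common⊆z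
          (∈-filter⁺ (_∈? tights (entry l)) (incident⇒∈ k i i∈k) (incident⇒∈ l i i∈l)))

    incidence : SpindleIncidence (length normals) (length entries) 6
    incidence = record
      { incident = incident
      ; vertex-separated = vertex-separated
      ; facet-inhabited = λ i → let k , i∈k = Any-at (facetsInhabited i) in k , ∈⇒incident k i i∈k
      ; facet-separated = facet-separated
      ; path = p
      ; path-distinct = pathDistinct
      ; path-edge = path-edge
      ; level = λ k → level (entry k)
      ; level-first = level-first
      ; level-last = level-last
      ; level-gap = level-gap
      ; apices = apices }

-- The data of Santos's spindle and their verification.

module Santos where

  open import Agda.Builtin.FromNat using (Number; fromNat)
  open import Agda.Builtin.FromNeg using (Negative; fromNeg)

  instance
    ℕ-literal : Number ℕ
    ℕ-literal = ℕₗ.number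
    ℤ-literal : Number ℤ
    ℤ-literal = ℤₗ.number
    ℤ-negative : Negative ℤ
    ℤ-negative = ℤₗ.negative
    Fin-literal : Number (Fin n)
    Fin-literal = Finₗ.number _

  -- A zero is not doubled, so no signed vector is repeated. The normals thus number 48, and the
  -- vertices 2 + 20 · 16 = 322.
  signings : Vec ℤ n → List (Vec ℤ n)
  signings []                = [] ∷ []
  signings (ℤ.+ zero ∷ v)    = map (0ℤ ∷_) (signings v)
  signings (x ∷ v)           = concatMap (λ w → (x ∷ w) ∷ (ℤ.- x ∷ w) ∷ []) (signings v)

  orbit : Vec ℤ (suc n) → List (Vec ℤ (suc n))
  orbit (x ∷ v) = map (x ∷_) (signings v)

  -- The vertices of Santos's prismatoid, the polar of the spindle, up to changes of signs and
  -- with the height coordinate moved to the front.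
  normalRows : List (Vec ℤ 5)
  normalRows =
      (1 ∷ 18 ∷ 0 ∷ 0 ∷ 0 ∷ [])
    ∷ (1 ∷ 0 ∷ 18 ∷ 0 ∷ 0 ∷ [])
    ∷ (1 ∷ 0 ∷ 0 ∷ 45 ∷ 0 ∷ [])
    ∷ (1 ∷ 0 ∷ 0 ∷ 0 ∷ 45 ∷ [])
    ∷ (1 ∷ 15 ∷ 15 ∷ 0 ∷ 0 ∷ [])
    ∷ (1 ∷ 0 ∷ 0 ∷ 30 ∷ 30 ∷ [])
    ∷ (1 ∷ 0 ∷ 10 ∷ 40 ∷ 0 ∷ [])
    ∷ (1 ∷ 10 ∷ 0 ∷ 0 ∷ 40 ∷ [])
    ∷ (-1 ∷ 0 ∷ 0 ∷ 0 ∷ 18 ∷ [])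
    ∷ (-1 ∷ 0 ∷ 0 ∷ 18 ∷ 0 ∷ [])
    ∷ (-1 ∷ 45 ∷ 0 ∷ 0 ∷ 0 ∷ [])
    ∷ (-1 ∷ 0 ∷ 45 ∷ 0 ∷ 0 ∷ [])
    ∷ (-1 ∷ 0 ∷ 0 ∷ 15 ∷ 15 ∷ [])
    ∷ (-1 ∷ 30 ∷ 30 ∷ 0 ∷ 0 ∷ [])
    ∷ (-1 ∷ 40 ∷ 0 ∷ 10 ∷ 0 ∷ [])
    ∷ (-1 ∷ 0 ∷ 40 ∷ 0 ∷ 10 ∷ [])
    ∷ []

  -- The vertices of the spindle up to signs, scaled by their least common denominator, each
  -- with its distance from the first apex.
  vertexRows : List (ℕ × Vec ℤ 5)
  vertexRows =
      (0 , (18900 ∷ 0 ∷ 0 ∷ 0 ∷ 0 ∷ []))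
    ∷ (6 , (-18900 ∷ 0 ∷ 0 ∷ 0 ∷ 0 ∷ []))
    ∷ (1 , (8100 ∷ 120 ∷ 600 ∷ 120 ∷ 240 ∷ []))
    ∷ (1 , (8100 ∷ 600 ∷ 120 ∷ 240 ∷ 120 ∷ []))
    ∷ (2 , (6300 ∷ 140 ∷ 560 ∷ 140 ∷ 280 ∷ []))
    ∷ (2 , (6300 ∷ 280 ∷ 560 ∷ 175 ∷ 245 ∷ []))
    ∷ (2 , (6300 ∷ 560 ∷ 140 ∷ 280 ∷ 140 ∷ []))
    ∷ (2 , (6300 ∷ 560 ∷ 280 ∷ 245 ∷ 175 ∷ []))
    ∷ (3 , (-3780 ∷ 252 ∷ 252 ∷ 252 ∷ 504 ∷ []))
    ∷ (3 , (-3780 ∷ 252 ∷ 252 ∷ 504 ∷ 252 ∷ []))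
    ∷ (3 , (3780 ∷ 252 ∷ 504 ∷ 252 ∷ 252 ∷ []))
    ∷ (3 , (5400 ∷ 270 ∷ 540 ∷ 180 ∷ 270 ∷ []))
    ∷ (3 , (3780 ∷ 504 ∷ 252 ∷ 252 ∷ 252 ∷ []))
    ∷ (3 , (5400 ∷ 540 ∷ 270 ∷ 270 ∷ 180 ∷ []))
    ∷ (4 , (-6300 ∷ 140 ∷ 280 ∷ 560 ∷ 140 ∷ []))
    ∷ (4 , (-6300 ∷ 175 ∷ 245 ∷ 560 ∷ 280 ∷ []))
    ∷ (4 , (-5400 ∷ 180 ∷ 270 ∷ 540 ∷ 270 ∷ []))
    ∷ (4 , (-6300 ∷ 245 ∷ 175 ∷ 280 ∷ 560 ∷ []))
    ∷ (4 , (-5400 ∷ 270 ∷ 180 ∷ 270 ∷ 540 ∷ []))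
    ∷ (4 , (-6300 ∷ 280 ∷ 140 ∷ 140 ∷ 560 ∷ []))
    ∷ (5 , (-8100 ∷ 120 ∷ 240 ∷ 600 ∷ 120 ∷ []))
    ∷ (5 , (-8100 ∷ 240 ∷ 120 ∷ 120 ∷ 600 ∷ []))
    ∷ []

  -- Also the common right-hand side: what is realised is the dilate `q · x ≤ scale`, whose vertices
  -- are integral and whose apices have height `scale` and its negative.
  scale : ℤ
  scale = 18900

  normals : List (Vec ℤ 5)
  normals = concatMap orbit normalRows

  #normals : ℕ
  #normals = length normals

  tightIndices : Vec ℤ 5 → ℕ → List (Vec ℤ 5) → List ℕ
  tightIndices p i []       = []
  tightIndices p i (q ∷ qs) =
    if does (dot q p ℤₚ.≟ scale) then i ∷ tightIndices p (suc i) qs else tightIndices p (suc i) qs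

  entries : List Entry
  entries = concatMap (λ (l , p) → map (λ x → record { level = l ; point = x ; tights = tightIndices x 0 normals }) (orbit p)) vertexRows

  #entries : ℕ
  #entries = length entries

  infix 9 ↗_ ↓_
  pattern ↗_ β = inj₁ β
  pattern ↓_ i = inj₂ i

  -- `exits` follows the order of `rows`: the `j`-th exit is the edge on which the `j`-th row stops
  -- being tight. Bases with the same `apex` subdivide the part of its normal cone over the chosen
  -- orthant.
  record Base : Set where
    constructor base
    field
      apex   : Fin 22
      rows   : Vec (Fin 18) 5
      exits  : Vec (Fin 44 ⊎ Fin 4) 5
      corner : Vec ℤ 5

  -- Restricting to one orthant makes the two directions of the axis extreme in the normal cones of
  -- the apices. No facet normal is parallel to the axis, so each direction is obtained as a sum of
  -- two normals that are mirror images.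
  functionals : Vec (Vec ℤ 5 × Vec ℤ 5) 18
  functionals = Vec.map (λ q → q , q) (fromList normalRows) Vec.++
    ((1 ∷ 18 ∷ 0 ∷ 0 ∷ 0 ∷ []) , (1 ∷ -18 ∷ 0 ∷ 0 ∷ 0 ∷ [])) ∷
    ((-1 ∷ 45 ∷ 0 ∷ 0 ∷ 0 ∷ []) , (-1 ∷ -45 ∷ 0 ∷ 0 ∷ 0 ∷ [])) ∷ []

  -- The corners are the vertices of { x : q · x ≤ b_q } for the 18 rows q, with right-hand
  -- sides b_q perturbed so as to make this polyhedron simple.
  bases : Vec Base 44
  bases =
      base 0 (1 ∷ 3 ∷ 5 ∷ 7 ∷ 16 ∷ []) (↓ 1 ∷ ↗ 1 ∷ ↓ 2 ∷ ↓ 0 ∷ ↗ 12 ∷ []) (1323000 ∷ 0 ∷ 4200 ∷ -2520 ∷ 0 ∷ [])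
    ∷ base 0 (1 ∷ 4 ∷ 5 ∷ 7 ∷ 16 ∷ []) (↗ 4 ∷ ↗ 0 ∷ ↓ 2 ∷ ↗ 2 ∷ ↗ 13 ∷ []) (1323000 ∷ 840 ∷ 4200 ∷ -2310 ∷ -210 ∷ [])
    ∷ base 0 (1 ∷ 4 ∷ 5 ∷ 6 ∷ 16 ∷ []) (↗ 5 ∷ ↓ 0 ∷ ↓ 3 ∷ ↗ 1 ∷ ↗ 14 ∷ []) (1323000 ∷ 840 ∷ 4200 ∷ -1050 ∷ -1470 ∷ [])
    ∷ base 0 (0 ∷ 2 ∷ 5 ∷ 6 ∷ 16 ∷ []) (↓ 0 ∷ ↗ 5 ∷ ↓ 3 ∷ ↓ 1 ∷ ↗ 15 ∷ []) (1323000 ∷ 2100 ∷ 0 ∷ 0 ∷ -2520 ∷ [])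
    ∷ base 0 (0 ∷ 4 ∷ 5 ∷ 7 ∷ 16 ∷ []) (↗ 1 ∷ ↓ 1 ∷ ↓ 2 ∷ ↗ 5 ∷ ↗ 16 ∷ []) (1323000 ∷ 2100 ∷ 2940 ∷ -1995 ∷ -525 ∷ [])
    ∷ base 0 (0 ∷ 4 ∷ 5 ∷ 6 ∷ 16 ∷ []) (↗ 2 ∷ ↗ 3 ∷ ↓ 3 ∷ ↗ 4 ∷ ↗ 17 ∷ []) (1323000 ∷ 2100 ∷ 2940 ∷ -735 ∷ -1785 ∷ [])
    ∷ base 1 (8 ∷ 11 ∷ 12 ∷ 13 ∷ 17 ∷ []) (↗ 7 ∷ ↗ 8 ∷ ↓ 2 ∷ ↓ 0 ∷ ↗ 10 ∷ []) (-1285200 ∷ 420 ∷ 840 ∷ -2100 ∷ 2100 ∷ [])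
    ∷ base 1 (9 ∷ 11 ∷ 12 ∷ 13 ∷ 17 ∷ []) (↗ 6 ∷ ↗ 9 ∷ ↓ 3 ∷ ↓ 0 ∷ ↗ 38 ∷ []) (-1285200 ∷ 420 ∷ 840 ∷ 0 ∷ 0 ∷ [])
    ∷ base 1 (8 ∷ 10 ∷ 12 ∷ 13 ∷ 17 ∷ []) (↗ 9 ∷ ↗ 6 ∷ ↓ 2 ∷ ↓ 1 ∷ ↗ 42 ∷ []) (-1285200 ∷ 840 ∷ 420 ∷ -2100 ∷ 2100 ∷ [])
    ∷ base 1 (9 ∷ 10 ∷ 12 ∷ 13 ∷ 17 ∷ []) (↗ 8 ∷ ↗ 7 ∷ ↓ 3 ∷ ↓ 1 ∷ ↗ 11 ∷ []) (-1285200 ∷ 840 ∷ 420 ∷ 0 ∷ 0 ∷ [])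
    ∷ base 1 (8 ∷ 11 ∷ 12 ∷ 13 ∷ 15 ∷ []) (↗ 40 ∷ ↗ 41 ∷ ↓ 2 ∷ ↓ 0 ∷ ↗ 6 ∷ []) (-1237950 ∷ 945 ∷ 1890 ∷ -1575 ∷ 4725 ∷ [])
    ∷ base 1 (9 ∷ 10 ∷ 12 ∷ 13 ∷ 14 ∷ []) (↗ 43 ∷ ↗ 39 ∷ ↓ 3 ∷ ↓ 1 ∷ ↗ 9 ∷ []) (-1275750 ∷ 1050 ∷ 525 ∷ 525 ∷ 105 ∷ [])
    ∷ base 2 (1 ∷ 3 ∷ 5 ∷ 7 ∷ 11 ∷ []) (↗ 18 ∷ ↗ 13 ∷ ↓ 2 ∷ ↓ 0 ∷ ↗ 0 ∷ []) (621000 ∷ 7800 ∷ 43200 ∷ 5280 ∷ 15600 ∷ [])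
    ∷ base 2 (1 ∷ 4 ∷ 5 ∷ 7 ∷ 11 ∷ []) (↗ 19 ∷ ↗ 12 ∷ ↓ 2 ∷ ↗ 14 ∷ ↗ 1 ∷ []) (621000 ∷ 8640 ∷ 43200 ∷ 5490 ∷ 15390 ∷ [])
    ∷ base 2 (1 ∷ 4 ∷ 5 ∷ 6 ∷ 11 ∷ []) (↗ 20 ∷ ↓ 0 ∷ ↓ 3 ∷ ↗ 13 ∷ ↗ 2 ∷ []) (621000 ∷ 8640 ∷ 43200 ∷ 6750 ∷ 14130 ∷ [])
    ∷ base 3 (0 ∷ 2 ∷ 5 ∷ 6 ∷ 10 ∷ []) (↗ 21 ∷ ↗ 17 ∷ ↓ 3 ∷ ↓ 1 ∷ ↗ 3 ∷ []) (594000 ∷ 42600 ∷ 8100 ∷ 16200 ∷ 5580 ∷ [])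
    ∷ base 3 (0 ∷ 4 ∷ 5 ∷ 7 ∷ 10 ∷ []) (↗ 22 ∷ ↓ 1 ∷ ↓ 2 ∷ ↗ 17 ∷ ↗ 4 ∷ []) (594000 ∷ 42600 ∷ 11040 ∷ 14205 ∷ 7575 ∷ [])
    ∷ base 3 (0 ∷ 4 ∷ 5 ∷ 6 ∷ 10 ∷ []) (↗ 23 ∷ ↗ 15 ∷ ↓ 3 ∷ ↗ 16 ∷ ↗ 5 ∷ []) (594000 ∷ 42600 ∷ 11040 ∷ 15465 ∷ 6315 ∷ [])
    ∷ base 4 (3 ∷ 5 ∷ 7 ∷ 11 ∷ 15 ∷ []) (↗ 27 ∷ ↓ 2 ∷ ↓ 0 ∷ ↗ 24 ∷ ↗ 12 ∷ []) (327600 ∷ 11060 ∷ 36680 ∷ 8540 ∷ 22120 ∷ [])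
    ∷ base 5 (4 ∷ 5 ∷ 7 ∷ 11 ∷ 13 ∷ []) (↗ 27 ∷ ↓ 2 ∷ ↗ 20 ∷ ↗ 22 ∷ ↗ 13 ∷ []) (491400 ∷ 20160 ∷ 40320 ∷ 9450 ∷ 15750 ∷ [])
    ∷ base 5 (4 ∷ 5 ∷ 6 ∷ 11 ∷ 13 ∷ []) (↗ 26 ∷ ↓ 3 ∷ ↗ 19 ∷ ↗ 23 ∷ ↗ 14 ∷ []) (491400 ∷ 20160 ∷ 40320 ∷ 10710 ∷ 14490 ∷ [])
    ∷ base 6 (2 ∷ 5 ∷ 6 ∷ 10 ∷ 14 ∷ []) (↗ 29 ∷ ↓ 3 ∷ ↓ 1 ∷ ↗ 25 ∷ ↗ 15 ∷ []) (441000 ∷ 39200 ∷ 9800 ∷ 19600 ∷ 7280 ∷ [])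
    ∷ base 7 (4 ∷ 5 ∷ 7 ∷ 10 ∷ 13 ∷ []) (↗ 28 ∷ ↓ 2 ∷ ↗ 23 ∷ ↗ 19 ∷ ↗ 16 ∷ []) (491400 ∷ 40320 ∷ 20160 ∷ 14490 ∷ 10710 ∷ [])
    ∷ base 7 (4 ∷ 5 ∷ 6 ∷ 10 ∷ 13 ∷ []) (↗ 29 ∷ ↓ 3 ∷ ↗ 22 ∷ ↗ 20 ∷ ↗ 17 ∷ []) (491400 ∷ 40320 ∷ 20160 ∷ 15750 ∷ 9450 ∷ [])
    ∷ base 8 (3 ∷ 5 ∷ 7 ∷ 13 ∷ 15 ∷ []) (↗ 27 ∷ ↓ 2 ∷ ↗ 34 ∷ ↗ 18 ∷ ↗ 36 ∷ []) (-196560 ∷ 16884 ∷ 20664 ∷ 14364 ∷ 33768 ∷ [])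
    ∷ base 9 (2 ∷ 5 ∷ 6 ∷ 13 ∷ 14 ∷ []) (↗ 29 ∷ ↓ 3 ∷ ↗ 32 ∷ ↗ 21 ∷ ↗ 33 ∷ []) (-264600 ∷ 17640 ∷ 17640 ∷ 35280 ∷ 15120 ∷ [])
    ∷ base 10 (5 ∷ 6 ∷ 11 ∷ 13 ∷ 15 ∷ []) (↗ 30 ∷ ↗ 27 ∷ ↗ 33 ∷ ↓ 0 ∷ ↗ 20 ∷ []) (-189000 ∷ 12600 ∷ 25200 ∷ 31500 ∷ 16380 ∷ [])
    ∷ base 11 (5 ∷ 7 ∷ 11 ∷ 13 ∷ 15 ∷ []) (↓ 2 ∷ ↗ 26 ∷ ↗ 24 ∷ ↗ 18 ∷ ↗ 19 ∷ []) (280800 ∷ 17820 ∷ 35640 ∷ 10620 ∷ 21600 ∷ [])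
    ∷ base 12 (5 ∷ 7 ∷ 10 ∷ 13 ∷ 14 ∷ []) (↗ 37 ∷ ↗ 29 ∷ ↗ 36 ∷ ↓ 1 ∷ ↗ 22 ∷ []) (83160 ∷ 31248 ∷ 15624 ∷ 15624 ∷ 23184 ∷ [])
    ∷ base 13 (5 ∷ 6 ∷ 10 ∷ 13 ∷ 14 ∷ []) (↓ 3 ∷ ↗ 28 ∷ ↗ 25 ∷ ↗ 21 ∷ ↗ 23 ∷ []) (378000 ∷ 37800 ∷ 18900 ∷ 18900 ∷ 10080 ∷ [])
    ∷ base 14 (2 ∷ 6 ∷ 11 ∷ 13 ∷ 15 ∷ []) (↗ 26 ∷ ↗ 40 ∷ ↗ 33 ∷ ↓ 0 ∷ ↓ 3 ∷ []) (-441000 ∷ 9800 ∷ 19600 ∷ 39200 ∷ 13580 ∷ [])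
    ∷ base 15 (2 ∷ 5 ∷ 12 ∷ 13 ∷ 15 ∷ []) (↗ 34 ∷ ↗ 40 ∷ ↗ 33 ∷ ↓ 0 ∷ ↗ 32 ∷ []) (-441000 ∷ 10675 ∷ 18725 ∷ 39200 ∷ 17080 ∷ [])
    ∷ base 15 (2 ∷ 5 ∷ 12 ∷ 13 ∷ 14 ∷ []) (↗ 35 ∷ ↗ 39 ∷ ↗ 25 ∷ ↓ 1 ∷ ↗ 31 ∷ []) (-441000 ∷ 12250 ∷ 17150 ∷ 39200 ∷ 17080 ∷ [])
    ∷ base 16 (2 ∷ 5 ∷ 6 ∷ 13 ∷ 15 ∷ []) (↗ 26 ∷ ↗ 30 ∷ ↗ 31 ∷ ↓ 0 ∷ ↗ 25 ∷ []) (-418500 ∷ 10800 ∷ 19350 ∷ 38700 ∷ 16830 ∷ [])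
    ∷ base 17 (3 ∷ 5 ∷ 12 ∷ 13 ∷ 15 ∷ []) (↗ 31 ∷ ↗ 41 ∷ ↗ 24 ∷ ↓ 0 ∷ ↗ 35 ∷ []) (-441000 ∷ 16205 ∷ 13195 ∷ 17080 ∷ 39200 ∷ [])
    ∷ base 17 (3 ∷ 5 ∷ 12 ∷ 13 ∷ 14 ∷ []) (↗ 32 ∷ ↗ 43 ∷ ↗ 36 ∷ ↓ 1 ∷ ↗ 34 ∷ []) (-441000 ∷ 17780 ∷ 11620 ∷ 17080 ∷ 39200 ∷ [])
    ∷ base 18 (3 ∷ 5 ∷ 7 ∷ 13 ∷ 14 ∷ []) (↗ 28 ∷ ↗ 37 ∷ ↗ 35 ∷ ↓ 1 ∷ ↗ 24 ∷ []) (-394200 ∷ 19080 ∷ 11880 ∷ 16560 ∷ 38160 ∷ [])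
    ∷ base 19 (3 ∷ 7 ∷ 10 ∷ 13 ∷ 14 ∷ []) (↗ 28 ∷ ↗ 43 ∷ ↗ 36 ∷ ↓ 1 ∷ ↓ 2 ∷ []) (-441000 ∷ 19600 ∷ 9800 ∷ 9800 ∷ 39200 ∷ [])
    ∷ base 20 (2 ∷ 9 ∷ 11 ∷ 12 ∷ 13 ∷ []) (↗ 7 ∷ ↗ 40 ∷ ↗ 39 ∷ ↓ 3 ∷ ↓ 0 ∷ []) (-540000 ∷ 8700 ∷ 17400 ∷ 41400 ∷ 8280 ∷ [])
    ∷ base 20 (2 ∷ 9 ∷ 12 ∷ 13 ∷ 14 ∷ []) (↗ 11 ∷ ↗ 32 ∷ ↓ 3 ∷ ↓ 1 ∷ ↗ 38 ∷ []) (-540000 ∷ 9225 ∷ 16875 ∷ 41400 ∷ 8280 ∷ [])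
    ∷ base 20 (2 ∷ 11 ∷ 12 ∷ 13 ∷ 15 ∷ []) (↗ 10 ∷ ↗ 31 ∷ ↗ 30 ∷ ↓ 0 ∷ ↗ 38 ∷ []) (-486000 ∷ 9300 ∷ 18600 ∷ 40200 ∷ 13080 ∷ [])
    ∷ base 21 (3 ∷ 8 ∷ 12 ∷ 13 ∷ 15 ∷ []) (↗ 10 ∷ ↗ 34 ∷ ↓ 2 ∷ ↓ 0 ∷ ↗ 42 ∷ []) (-567000 ∷ 15855 ∷ 9345 ∷ 5880 ∷ 42000 ∷ [])
    ∷ base 21 (3 ∷ 8 ∷ 10 ∷ 12 ∷ 13 ∷ []) (↗ 8 ∷ ↗ 43 ∷ ↗ 41 ∷ ↓ 2 ∷ ↓ 1 ∷ []) (-567000 ∷ 16800 ∷ 8400 ∷ 5880 ∷ 42000 ∷ [])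
    ∷ base 21 (3 ∷ 10 ∷ 12 ∷ 13 ∷ 14 ∷ []) (↗ 11 ∷ ↗ 35 ∷ ↗ 37 ∷ ↓ 1 ∷ ↗ 42 ∷ []) (-534600 ∷ 17520 ∷ 8760 ∷ 8760 ∷ 41280 ∷ [])
    ∷ []

  cones : Fin 44 → Cone 4 43
  cones β = record
    { functional = λ i → lookup functionals (lookup rows i)
    ; ray = lookup exits ; corner = corner ; vertex = proj₂ (List.lookup vertexRows apex) }
    where open Base (lookup bases β)

  -- After the apices, each orbit takes 16 places and starts with its representative with
  -- nonnegative coordinates off the height. The inner indices have the form 2 + 16k, with k = 0, 2,
  -- 6, 15, 19, and select one such vertex on each level from 1 to 5.
  path : Fin 7 → Fin #entries
  path = lookup (0 ∷ 2 ∷ 34 ∷ 98 ∷ 242 ∷ 306 ∷ 1 ∷ [])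

  open IncidenceTable scale normals entries

  normals₀≢0? : ∀ (qs : List (Vec ℤ 5)) → Dec (∀ i → lookup (List.lookup qs i) zero ≢ 0ℤ)
  normals₀≢0? qs = Finₚ.all? λ i → ¬? (lookup (List.lookup qs i) zero ℤₚ.≟ 0ℤ)

  AtVertex : Cone 4 43 → Fin 5 → Set
  AtVertex C i = dot (proj₁ (Cone.functional C i)) (Cone.vertex C) ≡ scale ×
                 dot (proj₂ (Cone.functional C i)) (Cone.vertex C) ≡ scale

  atVertex? : ∀ C i → Dec (AtVertex C i)
  atVertex? C i = (dot (proj₁ (Cone.functional C i)) (Cone.vertex C) ℤₚ.≟ scale) ×-dec
                  (dot (proj₂ (Cone.functional C i)) (Cone.vertex C) ℤₚ.≟ scale)

  -- Sealing the certificates keeps later uses from evaluating them again.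
  abstract

    verified : AllIncidences × AllSeparated × TightsBelow × FacetsInhabited × FacetsSeparated × LevelGaps × Bounded ×
      PathEdges path × PathDistinct path
    verified = decide (verified? path) ≡.refl

    apices : Apices path
    apices = decide (apices? path) ≡.refl

    normals₀≢0 : ∀ i → lookup (List.lookup normals i) zero ≢ 0ℤ
    normals₀≢0 = decide (normals₀≢0? normals) ≡.refl

    level-first : level (entry (path zero)) ≡ 0
    level-first = ≡.refl

    level-last : level (entry (path (fromℕ 6))) ≡ 6
    level-last = ≡.refl

    slope-diagonal : ∀ β j → slope cones β j j ℤ.< 0ℤ
    slope-diagonal = decide (Finₚ.all? λ (β : Fin 44) → Finₚ.all? λ (j : Fin 5) → slope cones β j j ℤₚ.<? 0ℤ) ≡.refl

    slope-off-diagonal : ∀ β i j → i ≡ j ⊎ slope cones β i j ≡ 0ℤ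
    slope-off-diagonal = decide (Finₚ.all? λ (β : Fin 44) → Finₚ.all? λ (i : Fin 5) →
      Finₚ.all? λ (j : Fin 5) → (i Finₚ.≟ j) ⊎-dec (slope cones β i j ℤₚ.≟ 0ℤ)) ≡.refl

    functional-at-vertex : ∀ β i → AtVertex (cones β) i
    functional-at-vertex = decide (Finₚ.all? λ (β : Fin 44) → Finₚ.all? λ (i : Fin 5) → atVertex? (cones β) i) ≡.refl

    -- Checking the 18 rows serves all 44 cones, since the generators of each are taken from these
    -- rows.
    functionals-listed : ∀ s r →
      Any (_≡ reflect s (proj₁ (lookup functionals r))) normals × Any (_≡ reflect s (proj₂ (lookup functionals r))) normals
    functionals-listed = decide (Vec-all? 4 λ s → Finₚ.all? λ (r : Fin 18) →
      any? (_≟ᵥ reflect s (proj₁ (lookup functionals r))) normals ×-dec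
      any? (_≟ᵥ reflect s (proj₂ (lookup functionals r))) normals) ≡.refl

    vertices-listed : ∀ s r → Any (λ e → point e ≡ reflect s (proj₂ (List.lookup vertexRows r))) entries
    vertices-listed = decide (Vec-all? 4 λ s → Finₚ.all? λ (r : Fin 22) →
      any? (λ e → point e ≟ᵥ reflect s (proj₂ (List.lookup vertexRows r))) entries) ≡.refl

    0<scale : 0ℤ ℤ.< scale
    0<scale = ℤ.+<+ (s≤s z≤n)

  santos : IntegerSpindle 4 #normals #entries 6 43
  santos =
    let allIncidences , allSeparated , tightsBelow , facetsInhabited , facetsSeparated , levelGaps ,
          bounded , pathEdges , pathDistinct = verified
    in record
    { incidence = incidence tightsBelow allSeparated facetsInhabited facetsSeparated levelGaps
                    path pathEdges pathDistinct apices level-first level-last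
    ; radius = scale
    ; 0<radius = 0<scale
    ; normal = List.lookup normals
    ; normal₀≢0 = normals₀≢0
    ; vertex = λ k → point (entry k)
    ; on-facet = on-facet allIncidences
    ; off-facet = off-facet allIncidences
    ; bound = scale
    ; bounded = λ k → All-at {xs = entries} bounded k
    ; cones = cones
    ; slope-diagonal = slope-diagonal
    ; slope-off-diagonal = off-diagonal
    ; functional-at-vertex = functional-at-vertex
    ; functional-listed = λ s β i →
        let a , b = functionals-listed s (lookup (Base.rows (lookup bases β)) i)
        in Any-at {xs = normals} a , Any-at {xs = normals} b
    ; vertex-listed = λ s β → Any-at {xs = entries} (vertices-listed s (Base.apex (lookup bases β))) }
    where
    off-diagonal : ∀ β {i j} → i ≢ j → slope cones β i j ≡ 0ℤ
    off-diagonal β {i} {j} i≢j with slope-off-diagonal β i j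
    ... | inj₁ i≡j = contradiction i≡j i≢j
    ... | inj₂ eq  = eq

theorem1p6 : ∀ {c ℓ₁ ℓ₂} (K : OrderedField c ℓ₁ ℓ₂) →
    let open Polyhedral K in
    Σ ℕ λ n → Σ (Spindle n 5) λ S →
    FacetCount S 48 × VertexCount S 322 × Length S 6
-- `#normals` and `#entries` evaluate to 48 and 322; the ambient dimension is that of the spindle.
theorem1p6 K = Realisation.realise K Santos.santos (s≤s z≤n)
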